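{- For every $X\subseteq\{C,D,M\}$, the model checking problem for $\mathrm{ELX}$ and the model checking problem for $\mathrm{ELX}^s$ are in P (decidable in time polynomial in the size of the input).
   Context: Languages. Fix a countably infinite set $\mathsf{Prop}$ and a finite nonempty set $\mathsf{Ag}$ of agents; groups are nonempty subsets of $\mathsf{Ag}$. $\mathcal{EL}$-formulas: $\varphi::=p\mid\neg\varphi\mid(\varphi\to\varphi)\mid K_a\varphi$. For $X\subseteq\{C,D,M\}$, $\mathcal{ELX}$ adds $C_G\varphi$, $D_G\varphi$, $M_G\varphi$ ($G$ a group) for the respective letters in $X$. $E_G\varphi:=\bigwedge_{a\in G}K_a\varphi$, $E_G^1\varphi:=E_G\varphi$, $E_G^{n}\varphi:=E_GE_G^{n-1}\varphi$. Models. A model is $M=(W,A,E,C,\nu)$ with $W\neq\emptyset$, $A$ a set, $E:W\times W\to\wp(A)$, $C:\mathsf{Ag}\to\wp(A)$, $\nu:W\to\wp(\mathsf{Prop})$. It is a similarity model if for all $s,t\in W$: $E(s,t)=A$ implies $s=t$, and $E(s,t)=E(t,s)$. Satisfaction: $M,s\models p$ iff $p\in\nu(s)$; Booleans as usual; $M,s\models K_a\psi$ iff $M,t\models\psi$ for all $t$ with $C(a)\subseteq E(s,t)$; $M,s\models C_G\psi$ iff $M,s\models E_G^n\psi$ for all $n\ge1$; $M,s\models D_G\psi$ iff $M,t\models\psi$ for all $t$ with $\bigcup_{a\in G}C(a)\subseteq E(s,t)$; $M,s\models M_G\psi$ iff $M,t\models\psi$ for all $t$ with $\bigcap_{a\in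 G}C(a)\subseteq E(s,t)$. Problem. The model checking problem for $\mathrm{ELX}$ (resp. $\mathrm{ELX}^s$): given an $\mathcal{ELX}$-formula $\varphi$, a finite model (resp. finite similarity model) $M$ and a state $s$ of $M$, decide whether $M,s\models\varphi$. Input size. The length $|\varphi|$: $|p|=1$, $|\neg\psi|=|\psi|+1$, $|(\psi\to\chi)|=|\psi|+|\chi|+3$, $|K_a\psi|=|\psi|+2$, $|C_G\psi|=|D_G\psi|=|M_G\psi|=|\psi|+2|G|+2$. The size of $M$ with respect to $\varphi$ is $|M|=|W|+|A|+|W|^2\cdot|A|+|\varphi|\cdot|A|+|W|\cdot|\varphi|$. The size of the input is $|\varphi|+|M|+1$. -}

module Defs where

open import Data.Bool.Base using (Bool; true; false; if_then_else_)
open import Data.Fin.Base using (Fin; fromℕ<; toℕ)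
open import Data.Fin.Patterns using (0F; 1F; 2F; 3F; 4F; 5F; 6F; 7F; 8F; 9F)
open import Data.Fin.Properties using (+↔⊎)
open import Data.Fin.Subset as Subset using (Subset; ∣_∣)
open import Data.Fin.Subset.Properties using (_∈?_)
open import Data.List.Base using
  (List; []; _∷_; _++_; [_]; map; filter; deduplicate; concatMap; replicate; allFin)
open import Data.Maybe.Base using (Maybe; just; nothing; maybe′)
open import Data.Nat.Base using (ℕ; zero; suc; _+_; _*_; _^_; _≤_; _≥_; NonZero; >-nonZero⁻¹)
open import Data.Nat.Properties using (_≟_)
open import Data.Product.Base using (∃-syntax; _×_; _,_; proj₁)
open import Data.Sum.Base using (_⊎_; inj₁; inj₂)
open import Data.Vec.Base as Vec using (Vec)
open import Function.Base using (_∘_)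
open import Function.Bundles using (_↔_; mk↔ₛ′)
open import Function.Properties.Inverse using (↔-sym; ↔-trans)
open import Level using (0ℓ)
open import Relation.Binary.PropositionalEquality using (_≡_; refl)
open import Relation.Nullary using (¬_; does; Reflects)
open import Relation.Unary using (Pred; _∈_; _⊆_; _≐_; ⋃; ⋂; Universal; U)

------------------------------------------------------------------------
-- Formulas

-- Common, distributed and mutual knowledge.
data Letter : Set where
  C D M : Letter

Atom : Set
Atom = ℕ

-- The agents are Fin n; groups are nonempty sets of agents.
record Group (n : ℕ) : Set where
  constructor group
  field
    members  : Subset n
    nonempty : Subset.Nonempty members

  Member : Set
  Member = ∃[ a ] a Subset.∈ members

open Group public

infixr 6 _⇒_

data Formula (n : ℕ) (X : Pred Letter 0ℓ) : Set where
  atom : Atom → Formula n X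
  neg  : Formula n X → Formula n X
  _⇒_  : Formula n X → Formula n X → Formula n X
  K    : Fin n → Formula n X → Formula n X
  box  : (l : Letter) → l ∈ X → Group n → Formula n X → Formula n X

length : ∀ {n X} → Formula n X → ℕ
length (atom p)      = 1
length (neg φ)       = length φ + 1
length (φ ⇒ ψ)       = length φ + length ψ + 3
length (K a φ)       = length φ + 2
length (box l _ G φ) = length φ + 2 * ∣ members G ∣ + 2

------------------------------------------------------------------------
-- Models

record Model (n : ℕ) : Set₁ where
  field
    State     : Set
    inhabited : State
    Ability   : Set
    edge      : State → State → Pred Ability 0ℓ
    cap       : Fin n → Pred Ability 0ℓ
    val       : State → Pred Atom 0ℓ

record IsSimilarity {n : ℕ} (𝓜 : Model n) : Set where
  open Model 𝓜
  field
    universal⇒≡ : ∀ s t → Universal (edge s t) → s ≡ t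
    symmetric   : ∀ s t → edge s t ≐ edge t s

module _ {n : ℕ} (𝓜 : Model n) where
  open Model 𝓜

  -- Truth of a modal formula at s, where P is the set of states satisfying
  -- the immediate subformula.

  Necessary : Pred Ability 0ℓ → Pred State 0ℓ → Pred State 0ℓ
  Necessary B P s = ∀ t → B ⊆ edge s t → P t

  Everyone : Group n → Pred State 0ℓ → Pred State 0ℓ
  Everyone G P s = ∀ a → a Subset.∈ members G → Necessary (cap a) P s

  Everyone^ : ℕ → Group n → Pred State 0ℓ → Pred State 0ℓ
  Everyone^ zero    G P = P
  Everyone^ (suc m) G P = Everyone G (Everyone^ m G P)

  Modal : Letter → Group n → Pred State 0ℓ → Pred State 0ℓ
  Modal C G P s = ∀ m → m ≥ 1 → Everyone^ m G P s
  Modal D G P   = Necessary (⋃ (Member G) (cap ∘ proj₁)) P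
  Modal M G P   = Necessary (⋂ (Member G) (cap ∘ proj₁)) P

infix 4 _,_⊨_

_,_⊨_ : ∀ {n X} (𝓜 : Model n) → Model.State 𝓜 → Formula n X → Set
𝓜 , s ⊨ atom p      = p ∈ Model.val 𝓜 s
𝓜 , s ⊨ neg φ       = ¬ (𝓜 , s ⊨ φ)
𝓜 , s ⊨ (φ ⇒ ψ)     = 𝓜 , s ⊨ φ → 𝓜 , s ⊨ ψ
𝓜 , s ⊨ K a φ       = Necessary 𝓜 (Model.cap 𝓜 a) (λ t → 𝓜 , t ⊨ φ) s
𝓜 , s ⊨ box l _ G φ = Modal 𝓜 l G (λ t → 𝓜 , t ⊨ φ) s

record FiniteModel (n : ℕ) : Set where
  field
    ∣W∣ ∣A∣    : ℕ
    .⦃ W≢∅ ⦄ : NonZero ∣W∣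
    edge      : Fin ∣W∣ → Fin ∣W∣ → Subset ∣A∣
    cap       : Fin n → Subset ∣A∣
    val       : Fin ∣W∣ → Atom → Bool

toModel : ∀ {n} → FiniteModel n → Model n
toModel 𝓕 = record
  { State     = Fin ∣W∣
  ; inhabited = fromℕ< (>-nonZero⁻¹ ∣W∣)
  ; Ability   = Fin ∣A∣
  ; edge      = λ s t x → x Subset.∈ edge s t
  ; cap       = λ a x → x Subset.∈ cap a
  ; val       = λ s p → val s p ≡ true
  }
  where open FiniteModel 𝓕

------------------------------------------------------------------------
-- Deterministic multi-tape Turing machines and the class P

Finite : Set → Set
Finite A = ∃[ m ] A ↔ Fin m

data Direction : Set where
  left right stay : Direction

-- A two-way infinite tape over the alphabet Maybe B, with blank symbol
-- nothing.  Both sides are listed starting from the cell next to the head,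
-- and all cells beyond the end of a list are blank.
record Tape (B : Set) : Set where
  constructor tape
  field
    before : List (Maybe B)
    head   : Maybe B
    after  : List (Maybe B)

module _ {B : Set} where

  -- The head is on the first symbol of the word.
  fromWord : List B → Tape B
  fromWord []       = tape [] nothing []
  fromWord (x ∷ xs) = tape [] (just x) (map just xs)

  move : Direction → Tape B → Tape B
  move left  (tape []       x rs)       = tape [] nothing (x ∷ rs)
  move left  (tape (l ∷ ls) x rs)       = tape ls l (x ∷ rs)
  move right (tape ls       x [])       = tape (x ∷ ls) nothing []
  move right (tape ls       x (r ∷ rs)) = tape (x ∷ ls) r rs
  move stay  t                          = t

  writeMove : Maybe B × Direction → Tape B → Tape B
  writeMove (y , d) (tape ls _ rs) = move d (tape ls y rs)

-- The machine scans blanks, input symbols and auxiliary symbols.  It halts in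
-- the states q with verdict q ≡ just b: it accepts if b is true and rejects
-- if b is false.
record TuringMachine (Input : Set) : Set₁ where
  field
    Control     : Set
    Auxiliary   : Set
    control-fin : Finite Control
    aux-fin     : Finite Auxiliary
    extraTapes  : ℕ

  tapes : ℕ
  tapes = suc extraTapes

  Symbol : Set
  Symbol = Maybe (Input ⊎ Auxiliary)

  field
    start   : Control
    verdict : Control → Maybe Bool
    δ       : Control → Vec Symbol tapes → Control × Vec (Symbol × Direction) tapes

  Configuration : Set
  Configuration = Control × Vec (Tape (Input ⊎ Auxiliary)) tapes

  initial : List Input → Configuration
  initial w = start , fromWord (map inj₁ w) Vec.∷ Vec.replicate extraTapes (fromWord [])

  act : Control × Vec (Symbol × Direction) tapes →
        Vec (Tape (Input ⊎ Auxiliary)) tapes → Configuration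
  act (q , actions) ts = q , Vec.zipWith writeMove actions ts

  -- Halting configurations are fixed.
  step : Configuration → Configuration
  step (q , ts) =
    maybe′ (λ _ → q , ts) (act (δ q (Vec.map Tape.head ts)) ts) (verdict q)

  run : ℕ → Configuration → Configuration
  run zero    c = c
  run (suc m) c = run m (step c)

  HaltsWithin : ℕ → List Input → Bool → Set
  HaltsWithin bound w b =
    ∃[ m ] m ≤ bound × verdict (proj₁ (run m (initial w))) ≡ just b

record DecisionProblem : Set₁ where
  field
    Instance : Set
    Yes      : Pred Instance 0ℓ
    size     : Instance → ℕ
    Input    : Set
    finite   : Finite Input
    encode   : Instance → List Input

-- The time is measured against the declared size of an instance, not
-- against the length of its encoding.
record InP (Π : DecisionProblem) : Set₁ where
  open DecisionProblem Π
  field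
    machine  : TuringMachine Input
    coeff    : ℕ
    exponent : ℕ
    decides  : ∀ x → ∃[ b ] Reflects (Yes x) b ×
      TuringMachine.HaltsWithin machine (coeff * size x ^ exponent) (encode x) b

------------------------------------------------------------------------
-- Encoding of model checking instances

data Token (n : ℕ) : Set where
  agent           : Fin n → Token n
  modal           : Letter → Token n
  bit             : Bool → Token n
  not imp know    : Token n
  tally comma end : Token n

private
  fixed : ∀ {n} → Token n ↔ (Fin n ⊎ Fin 11)
  fixed {n} = mk↔ₛ′ to from to∘from from∘to
    where
    pattern 10F = Fin.suc 9F

    to : Token n → Fin n ⊎ Fin 11
    to (agent a)   = inj₁ a
    to (modal C)   = inj₂ 0F
    to (modal D)   = inj₂ 1F
    to (modal M)   = inj₂ 2F
    to (bit false) = inj₂ 3F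
    to (bit true)  = inj₂ 4F
    to not         = inj₂ 5F
    to imp         = inj₂ 6F
    to know        = inj₂ 7F
    to tally       = inj₂ 8F
    to comma       = inj₂ 9F
    to end         = inj₂ 10F

    from : Fin n ⊎ Fin 11 → Token n
    from (inj₁ a)   = agent a
    from (inj₂ 0F)  = modal C
    from (inj₂ 1F)  = modal D
    from (inj₂ 2F)  = modal M
    from (inj₂ 3F)  = bit false
    from (inj₂ 4F)  = bit true
    from (inj₂ 5F)  = not
    from (inj₂ 6F)  = imp
    from (inj₂ 7F)  = know
    from (inj₂ 8F)  = tally
    from (inj₂ 9F)  = comma
    from (inj₂ 10F) = end

    to∘from : ∀ y → to (from y) ≡ y
    to∘from (inj₁ a)   = refl
    to∘from (inj₂ 0F)  = refl
    to∘from (inj₂ 1F)  = refl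
    to∘from (inj₂ 2F)  = refl
    to∘from (inj₂ 3F)  = refl
    to∘from (inj₂ 4F)  = refl
    to∘from (inj₂ 5F)  = refl
    to∘from (inj₂ 6F)  = refl
    to∘from (inj₂ 7F)  = refl
    to∘from (inj₂ 8F)  = refl
    to∘from (inj₂ 9F)  = refl
    to∘from (inj₂ 10F) = refl

    from∘to : ∀ x → from (to x) ≡ x
    from∘to (agent a)   = refl
    from∘to (modal C)   = refl
    from∘to (modal D)   = refl
    from∘to (modal M)   = refl
    from∘to (bit false) = refl
    from∘to (bit true)  = refl
    from∘to not         = refl
    from∘to imp         = refl
    from∘to know        = refl
    from∘to tally       = refl
    from∘to comma       = refl
    from∘to end         = refl

token-finite : ∀ n → Finite (Token n)
token-finite n = n + 11 , ↔-trans fixed (↔-sym +↔⊎)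

-- An occurrence of an atom has length 1 whatever the atom is, and the size of
-- a model has the term ∣W∣ * length φ for its valuation.  So atoms are not
-- written by their index in ℕ: they are numbered in order of first occurrence
-- in φ, and only the valuation of these atoms is written.

occurrences : ∀ {n X} → Formula n X → List Atom
occurrences (atom p)      = [ p ]
occurrences (neg φ)       = occurrences φ
occurrences (φ ⇒ ψ)       = occurrences φ ++ occurrences ψ
occurrences (K a φ)       = occurrences φ
occurrences (box l _ G φ) = occurrences φ

atoms : ∀ {n X} → Formula n X → List Atom
atoms φ = deduplicate _≟_ (occurrences φ)

position : Atom → List Atom → ℕ
position p []       = 0
position p (q ∷ qs) = if does (p ≟ q) then 0 else suc (position p qs)

module _ {n : ℕ} where

  unary : ℕ → List (Token n)
  unary m = replicate m tally ++ [ comma ]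

  row : ∀ {m} → Vec Bool m → List (Token n)
  row v = map bit (Vec.toList v) ++ [ comma ]

  agents : Group n → List (Token n)
  agents G = map agent (filter (_∈? members G) (allFin n)) ++ [ comma ]

  -- Reverse Polish notation, with atoms numbered by their position in ps.
  encodeFormula : ∀ {X} → List Atom → Formula n X → List (Token n)
  encodeFormula ps (atom p)      = unary (position p ps)
  encodeFormula ps (neg φ)       = encodeFormula ps φ ++ [ not ]
  encodeFormula ps (φ ⇒ ψ)       = encodeFormula ps φ ++ encodeFormula ps ψ ++ [ imp ]
  encodeFormula ps (K a φ)       = encodeFormula ps φ ++ know ∷ agent a ∷ []
  encodeFormula ps (box l _ G φ) = encodeFormula ps φ ++ modal l ∷ agents G

  encodeModel : List Atom → FiniteModel n → List (Token n)
  encodeModel ps 𝓕 =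
       unary ∣W∣
    ++ unary ∣A∣
    ++ concatMap (λ a → row (cap a)) (allFin n) ++ end
     ∷ concatMap (λ s → concatMap (λ t → row (edge s t)) (allFin ∣W∣)) (allFin ∣W∣) ++ end
     ∷ concatMap (λ p → row (Vec.tabulate (λ s → val s p))) ps ++ [ end ]
    where open FiniteModel 𝓕

------------------------------------------------------------------------
-- The model checking problems

record MCInstance (n : ℕ) (X : Pred Letter 0ℓ) (𝓒 : Pred (FiniteModel n) 0ℓ) : Set where
  field
    formula : Formula n X
    model   : FiniteModel n
    inClass : model ∈ 𝓒
    state   : Fin (FiniteModel.∣W∣ model)

modelSize : ∀ {n} → FiniteModel n → ℕ → ℕ
modelSize 𝓕 l = ∣W∣ + ∣A∣ + ∣W∣ ^ 2 * ∣A∣ + l * ∣A∣ + ∣W∣ * l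
  where open FiniteModel 𝓕

ModelChecking : (n : ℕ) → Pred Letter 0ℓ → Pred (FiniteModel n) 0ℓ → DecisionProblem
ModelChecking n X 𝓒 = record
  { Instance = MCInstance n X 𝓒
  ; Yes      = λ x → toModel (model x) , state x ⊨ formula x
  ; size     = λ x → length (formula x) + modelSize (model x) (length (formula x)) + 1
  ; Input    = Token n
  ; finite   = token-finite n
  ; encode   = λ x → encodeModel (atoms (formula x)) (model x)
                  ++ unary (toℕ (state x))
                  ++ encodeFormula (atoms (formula x)) (formula x) ++ [ end ]
  }
  where open MCInstance

MC-EL : (n : ℕ) → Pred Letter 0ℓ → DecisionProblem
MC-EL n X = ModelChecking n X U

MC-ELˢ : (n : ℕ) → Pred Letter 0ℓ → DecisionProblem
MC-ELˢ n X = ModelChecking n X (IsSimilarity ∘ toModel)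

{-# OPTIONS --safe #-}
module Submission where

-- Formulas are evaluated bottom up: reading the reverse Polish notation, one
-- keeps a stack of truth vectors over the states of the model.  A modality is
-- evaluated by comparing a set of abilities with all edges, and common
-- knowledge of P is the limit of Z := E (P and Z), which starts from the set of
-- all states and is constant after at most |W| steps.
--
-- The algorithm is a program over finitely many stacks whose only loops run
-- exactly N times, where N is the length of the input.  Nesting depth d then
-- gives the time bound O((N + 1) ^ d) from the syntax alone, so correctness and
-- running time separate.  A tape of a Turing machine is a stack (the cells
-- before the head), and a loop counter is a pair of stacks between which N
-- symbols are moved.

open import Defs
open import Data.Bool.Base using (Bool; true; false; if_then_else_; _∧_; _∨_) renaming (not to ¬ᵇ_)
open import Data.Empty using (⊥; ⊥-elim)
open import Data.Fin.Base using (Fin; zero; suc; toℕ)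
open import Data.Fin.Patterns
open import Data.Fin.Properties as Fin using (+↔⊎; toℕ<n)
import Data.Fin.Subset as Subset
import Data.Fin.Subset.Properties as Subset
open import Data.List.Base as List
  using (List; []; _∷_; _++_; _ʳ++_; reverse; drop; map; foldl; allFin; tabulate; concatMap;
         replicate)
open import Data.List.Membership.Propositional using (_∈_)
open import Data.List.Membership.Propositional.Properties
  using (∈-deduplicate⁺; ∈-filter⁺; ∈-filter⁻; ∈-allFin)
open import Data.List.Properties
  using (++-assoc; ++-identityʳ; length-++; length-deduplicate; length-filter; length-map;
         length-replicate; length-reverse; length-tabulate; map-∘; map-cong; map-id; map-tabulate;
         reverse-involutive; reverse-map; ʳ++-defn)
open import Data.List.Relation.Unary.All as All using (All; []; _∷_)
import Data.List.Relation.Unary.All.Properties as All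
open import Data.List.Relation.Unary.Any using (here; there)
open import Data.Maybe.Base as Maybe using (Maybe; just; nothing; maybe′)
open import Data.Nat.Base
  using (ℕ; zero; suc; _+_; _*_; _^_; _≤_; _<_; _⊔_; z≤n; s≤s; NonZero; >-nonZero)
open import Data.Nat.Properties
open import Data.Nat.Solver using (module +-*-Solver)
open import Data.Product.Base using (Σ; ∃-syntax; _×_; _,_; proj₁; proj₂; map₁)
open import Data.Product.Function.Dependent.Propositional using (Σ-↔)
open import Data.Sum.Base using (_⊎_; inj₁; inj₂; [_,_]′)
open import Data.Sum.Function.Propositional using (_⊎-↔_)
open import Data.Unit.Base using (⊤; tt)
open import Data.Vec.Base as Vec using (Vec; []; _∷_; lookup; updateAt; _[_]≔_)
open import Data.Vec.Properties as Vec
  using (lookup∘updateAt; lookup∘updateAt′; lookup-map; lookup-replicate; []=⇒lookup; lookup⇒[]=)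
open import Function.Base using (_∘_; id; case_of_)
open import Function.Bundles using (_↔_; mk↔ₛ′; _⇔_; mk⇔; module Inverse; module Equivalence)
open import Function.Construct.Identity using (↔-id)
open import Function.Properties.Inverse using (↔-sym; ↔-trans)
open import Level using (0ℓ)
open import Relation.Binary.PropositionalEquality
  using (_≡_; _≢_; refl; sym; trans; cong; cong₂; subst; module ≡-Reasoning)
open import Relation.Nullary using (Reflects; ofʸ; ofⁿ; does; yes; no; contradiction)
open import Relation.Nullary.Decidable using (False; toWitnessFalse; dec-true; dec-false)
open import Relation.Unary using (Pred; ⋃; ⋂)

-- Finite types

-- Loops of fixed length shape the whole development. A loop body must leave the store unchanged
-- once its data is exhausted, and every list that a loop traverses must have length at most N. The
-- latter holds because truth vectors, table rows and groups are never longer than something that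
-- occurs in the input.
--
-- For common knowledge it would not do to iterate E on P: accessibility need not be reflexive, so
-- the powers of E applied to P need not decrease and may alternate for ever. The iterates of
-- `E (P and Z)` from the full set are the conjunctions of the first powers, and these do decrease.
--
-- The size of an instance bounds N only quadratically, and the number of agents is fixed, so it may
-- enter the coefficient. This explains why the final exponent is twice the one obtained in terms of
-- N.

Fin-finite : ∀ m → Finite (Fin m)
Fin-finite m = m , ↔-id (Fin m)

⊎-finite : ∀ {A B : Set} → Finite A → Finite B → Finite (A ⊎ B)
⊎-finite (m , f) (k , g) = m + k , ↔-trans (f ⊎-↔ g) (↔-sym +↔⊎)

↔-finite : ∀ {A B : Set} → A ↔ B → Finite B → Finite A
↔-finite f (m , g) = m , ↔-trans f g

Bool-finite : Finite Bool
Bool-finite = ↔-finite (mk↔ₛ′ to from to∘from from∘to) (Fin-finite 2)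
  where
  to : Bool → Fin 2
  to false = zero
  to true  = suc zero

  from : Fin 2 → Bool
  from zero    = false
  from (suc _) = true

  to∘from : ∀ i → to (from i) ≡ i
  to∘from zero       = refl
  to∘from (suc zero) = refl

  from∘to : ∀ b → from (to b) ≡ b
  from∘to false = refl
  from∘to true  = refl

Maybe-finite : ∀ {A : Set} → Finite A → Finite (Maybe A)
Maybe-finite {A} fin = ↔-finite (mk↔ₛ′ to from to∘from from∘to) (⊎-finite (Fin-finite 1) fin)
  where
  to : Maybe A → Fin 1 ⊎ A
  to nothing  = inj₁ zero
  to (just x) = inj₂ x

  from : Fin 1 ⊎ A → Maybe A
  from (inj₁ _) = nothing
  from (inj₂ x) = just x

  to∘from : ∀ y → to (from y) ≡ y
  to∘from (inj₁ zero) = refl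
  to∘from (inj₂ x)    = refl

  from∘to : ∀ x → from (to x) ≡ x
  from∘to nothing  = refl
  from∘to (just x) = refl

Σ-Fin-finite : ∀ m {B : Fin m → Set} → (∀ i → Finite (B i)) → Finite (Σ (Fin m) B)
Σ-Fin-finite zero    fin = 0 , mk↔ₛ′ (λ ()) (λ ()) (λ ()) (λ ())
Σ-Fin-finite (suc m) {B} fin =
  ↔-finite (mk↔ₛ′ to from to∘from from∘to)
    (⊎-finite (fin zero) (Σ-Fin-finite m (fin ∘ suc)))
  where
  to : Σ (Fin (suc m)) B → B zero ⊎ Σ (Fin m) (B ∘ suc)
  to (zero  , b) = inj₁ b
  to (suc i , b) = inj₂ (i , b)

  from : B zero ⊎ Σ (Fin m) (B ∘ suc) → Σ (Fin (suc m)) B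
  from (inj₁ b)       = zero , b
  from (inj₂ (i , b)) = suc i , b

  to∘from : ∀ y → to (from y) ≡ y
  to∘from (inj₁ b)       = refl
  to∘from (inj₂ (i , b)) = refl

  from∘to : ∀ x → from (to x) ≡ x
  from∘to (zero  , b) = refl
  from∘to (suc i , b) = refl

Σ-finite : ∀ {A : Set} {B : A → Set} → Finite A → (∀ a → Finite (B a)) → Finite (Σ A B)
Σ-finite {A} {B} (m , f) fin =
  ↔-finite (Σ-↔ f (λ {x} → subst (λ y → B x ↔ B y) (sym (strictlyInverseʳ x)) (↔-id (B x))))
    (Σ-Fin-finite m (fin ∘ from))
  where open Inverse f

max-Fin : ∀ m → (Fin m → ℕ) → ℕ
max-Fin zero    f = 0
max-Fin (suc m) f = f zero ⊔ max-Fin m (f ∘ suc)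

≤max-Fin : ∀ m (f : Fin m → ℕ) i → f i ≤ max-Fin m f
≤max-Fin (suc m) f zero    = m≤m⊔n _ _
≤max-Fin (suc m) f (suc i) = ≤-trans (≤max-Fin m (f ∘ suc) i) (m≤n⊔m (f zero) _)

-- Needed for `pop`: every symbol has its own continuation with its own time constant, and
-- finiteness of the alphabet gives a common one.
finite-bounded : ∀ {A : Set} → Finite A → (f : A → ℕ) → ∃[ b ] (∀ a → f a ≤ b)
finite-bounded (m , g) f = max-Fin m (f ∘ from) , λ a →
  subst (λ x → f x ≤ max-Fin m (f ∘ from)) (strictlyInverseʳ a) (≤max-Fin m (f ∘ from) (to a))
  where open Inverse g

-- A programming language for stacks

data Iter {S : Set} (R : S → S → Set) : ℕ → S → S → Set where
  []  : ∀ {σ} → Iter R 0 σ σ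
  _∷_ : ∀ {m σ σ′ σ″} → R σ σ′ → Iter R m σ′ σ″ → Iter R (suc m) σ σ″

module Stacks (Γ : Set) (k : ℕ) where

  Store : ℕ → Set
  Store zero    = ⊤
  Store (suc m) = List Γ × Store m

  get : ∀ {m} → Fin m → Store m → List Γ
  get zero    (x , σ) = x
  get (suc i) (x , σ) = get i σ

  set : ∀ {m} → Fin m → List Γ → Store m → Store m
  set zero    y (x , σ) = y , σ
  set (suc i) y (x , σ) = x , set i y σ

  empty : ∀ m → Store m
  empty zero    = tt
  empty (suc m) = [] , empty m

  get-empty : ∀ m i → get i (empty m) ≡ []
  get-empty (suc m) zero    = refl
  get-empty (suc m) (suc i) = get-empty m i

  get-set : ∀ {m} (i : Fin m) y σ → get i (set i y σ) ≡ y
  get-set zero    y σ       = refl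
  get-set (suc i) y (_ , σ) = get-set i y σ

  get-set-≢ : ∀ {m} (i j : Fin m) y σ → i ≢ j → get i (set j y σ) ≡ get i σ
  get-set-≢ zero    zero    y σ       i≢j with () ← i≢j refl
  get-set-≢ zero    (suc j) y (_ , σ) i≢j = refl
  get-set-≢ (suc i) zero    y (_ , σ) i≢j = refl
  get-set-≢ (suc i) (suc j) y (_ , σ) i≢j = get-set-≢ i j y σ (i≢j ∘ cong suc)

  set-set : ∀ {m} (i : Fin m) x y σ → set i x (set i y σ) ≡ set i x σ
  set-set zero    x y σ       = refl
  set-set (suc i) x y (z , σ) = cong (z ,_) (set-set i x y σ)

  set-get : ∀ {m} (i : Fin m) σ → set i (get i σ) σ ≡ σ
  set-get zero    σ       = refl
  set-get (suc i) (z , σ) = cong (z ,_) (set-get i σ)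

  set-comm : ∀ {m} (i j : Fin m) x y σ → i ≢ j → set i x (set j y σ) ≡ set j y (set i x σ)
  set-comm zero    zero    x y σ       i≢j with () ← i≢j refl
  set-comm zero    (suc j) x y σ       i≢j = refl
  set-comm (suc i) zero    x y σ       i≢j = refl
  set-comm (suc i) (suc j) x y (z , σ) i≢j = cong (z ,_) (set-comm i j x y σ (i≢j ∘ cong suc))

  infixr 5 _⨾_

  -- The index bounds the nesting of loops.
  data Prog : ℕ → Set where
    skip   : ∀ {d} → Prog d
    push   : ∀ {d} → Fin k → Γ → Prog d
    pop    : ∀ {d} → Fin k → (Maybe Γ → Prog d) → Prog d
    _⨾_    : ∀ {d} → Prog d → Prog d → Prog d
    repeat : ∀ {d} → Prog d → Prog (suc d)

  -- Every loop runs exactly N times, where N will be the length of the input,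
  -- so that the syntax of a program alone bounds its running time.
  data Exec (N : ℕ) : ∀ {d} → Prog d → Store k → Store k → Set where
    skip   : ∀ {d σ} → Exec N {d} skip σ σ
    push   : ∀ {d i x σ} → Exec N {d} (push i x) σ (set i (x ∷ get i σ) σ)
    pop    : ∀ {d i} {f : Maybe Γ → Prog d} {σ σ′} →
             Exec N (f (List.head (get i σ))) (set i (drop 1 (get i σ)) σ) σ′ →
             Exec N (pop i f) σ σ′
    _⨾_    : ∀ {d} {p q : Prog d} {σ σ′ σ″} →
             Exec N p σ σ′ → Exec N q σ′ σ″ → Exec N (p ⨾ q) σ σ″
    repeat : ∀ {d} {p : Prog d} {σ σ′} → Iter (Exec N p) N σ σ′ → Exec N (repeat p) σ σ′

-- Compilation to Turing machines

module Compiler {Γ : Set} (Γ-finite : Finite Γ) (k : ℕ) where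

  open Stacks Γ (suc k)

  Sym : Set
  Sym = Maybe (Γ ⊎ Fin 0)

  Tp : Set
  Tp = Tape (Γ ⊎ Fin 0)

  -- Two tapes for the counter of every nested loop, then one per register.
  width : ℕ → ℕ
  width zero    = suc k
  width (suc d) = suc (suc (width d))

  Actions : ℕ → Set
  Actions m = Vec (Sym × Direction) m

  heads : ∀ {m} → Vec Tp m → Vec Sym m
  heads = Vec.map Tape.head

  infixl 5 _▷_

  _▷_ : ∀ {m} → Vec Tp m → Actions m → Vec Tp m
  ts ▷ as = Vec.zipWith writeMove as ts

  idle : ∀ {m} → Vec Sym m → Actions m
  idle = Vec.map (_, stay)

  ▷-idle : ∀ {m} (ts : Vec Tp m) → ts ▷ idle (heads ts) ≡ ts
  ▷-idle []       = refl
  ▷-idle (t ∷ ts) = cong (t ∷_) (▷-idle ts)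

  ▷-one : ∀ {m} (ts : Vec Tp m) i a →
          ts ▷ (idle (heads ts) [ i ]≔ a) ≡ updateAt ts i (writeMove a)
  ▷-one (t ∷ ts) zero    a = cong (writeMove a t ∷_) (▷-idle ts)
  ▷-one (t ∷ ts) (suc i) a = cong (t ∷_) (▷-one ts i a)

  -- A piece of a machine without verdicts. Exit is signalled by `nothing` in place of a next state,
  -- but the exiting transition still writes and moves, so that a surrounding fragment can redirect
  -- it at no extra cost.
  record Fragment (m : ℕ) : Set₁ where
    field
      Q      : Set
      finite : Finite Q
      entry  : Q
      δ      : Q → Vec Sym m → Maybe Q × Actions m

  data Runs {m} (F : Fragment m) : ℕ → Fragment.Q F → Vec Tp m → Vec Tp m → Set where
    exit : ∀ {q as ts ts′} → Fragment.δ F q (heads ts) ≡ (nothing , as) →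
           ts ▷ as ≡ ts′ → Runs F 1 q ts ts′
    next : ∀ {t q q′ as ts ts′ ts″} → Fragment.δ F q (heads ts) ≡ (just q′ , as) →
           ts ▷ as ≡ ts′ → Runs F t q′ ts′ ts″ → Runs F (suc t) q ts ts″

  cell : Γ → Sym
  cell = just ∘ inj₁

  cells : List Γ → List Sym
  cells = List.map cell

  decode : Sym → Maybe Γ
  decode nothing         = nothing
  decode (just (inj₁ x)) = just x

  register : ∀ d → Fin (suc k) → Fin (width d)
  register zero    i = i
  register (suc d) i = suc (suc (register d i))

  single : ∀ {m} → (Vec Sym m → Actions m) → Fragment m
  single f = record
    { Q = Fin 1 ; finite = Fin-finite 1 ; entry = zero ; δ = λ _ hs → nothing , f hs }

  -- The head stands just past the top of the stack, so popping takes two transitions, a move to the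
  -- left and a read. The popped symbol stays in the control state for the rest of the branch, since
  -- each symbol has its own fragment. On an empty stack the read finds a blank.
  popF : ∀ {m} → Fin m → (Maybe Γ → Fragment m) → Fragment m
  popF {m} i F = record
    { Q      = Bool ⊎ Σ (Maybe Γ) (Fragment.Q ∘ F)
    ; finite = ⊎-finite Bool-finite (Σ-finite (Maybe-finite Γ-finite) (Fragment.finite ∘ F))
    ; entry  = inj₁ false
    ; δ      = step′
    }
    where
    step′ : Bool ⊎ Σ (Maybe Γ) (Fragment.Q ∘ F) → Vec Sym m →
            Maybe (Bool ⊎ Σ (Maybe Γ) (Fragment.Q ∘ F)) × Actions m
    step′ (inj₁ false)   hs = just (inj₁ true) , idle hs [ i ]≔ (lookup hs i , left)
    step′ (inj₁ true)    hs =
      just (inj₂ (decode (lookup hs i) , Fragment.entry (F (decode (lookup hs i))))) , idle hs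
    step′ (inj₂ (x , q)) hs = map₁ (Maybe.map (λ q′ → inj₂ (x , q′))) (Fragment.δ (F x) q hs)

  seqF : ∀ {m} → Fragment m → Fragment m → Fragment m
  seqF {m} F G = record
    { Q      = Fragment.Q F ⊎ Fragment.Q G
    ; finite = ⊎-finite (Fragment.finite F) (Fragment.finite G)
    ; entry  = inj₁ (Fragment.entry F)
    ; δ      = step′
    }
    where
    step′ : Fragment.Q F ⊎ Fragment.Q G → Vec Sym m →
            Maybe (Fragment.Q F ⊎ Fragment.Q G) × Actions m
    step′ (inj₁ q) hs = map₁ (just ∘ maybe′ inj₁ (inj₂ (Fragment.entry G))) (Fragment.δ F q hs)
    step′ (inj₂ q) hs = map₁ (Maybe.map inj₂) (Fragment.δ G q hs)

  data Phase : Set where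
    pop₁ read₁ pop₂ read₂ : Phase

  Phase-finite : Finite Phase
  Phase-finite = ↔-finite (mk↔ₛ′ to from to∘from from∘to) (Fin-finite 4)
    where
    to : Phase → Fin 4
    to pop₁  = zero
    to read₁ = suc zero
    to pop₂  = suc (suc zero)
    to read₂ = suc (suc (suc zero))

    from : Fin 4 → Phase
    from zero                = pop₁
    from (suc zero)          = read₁
    from (suc (suc zero))    = pop₂
    from (suc (suc (suc _))) = read₂

    to∘from : ∀ i → to (from i) ≡ i
    to∘from zero                   = refl
    to∘from (suc zero)             = refl
    to∘from (suc (suc zero))       = refl
    to∘from (suc (suc (suc zero))) = refl

    from∘to : ∀ q → from (to q) ≡ q
    from∘to pop₁  = refl
    from∘to read₁ = refl
    from∘to pop₂  = refl
    from∘to read₂ = refl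

  -- The counter is moved from the first tape to the second one symbol per
  -- iteration, and back at the end.
  repeatF : ∀ {m} → Fragment m → Fragment (suc (suc m))
  repeatF {m} F = record
    { Q      = Phase ⊎ Fragment.Q F
    ; finite = ⊎-finite Phase-finite (Fragment.finite F)
    ; entry  = inj₁ pop₁
    ; δ      = step′
    }
    where
    step′ : Phase ⊎ Fragment.Q F → Vec Sym (suc (suc m)) →
            Maybe (Phase ⊎ Fragment.Q F) × Actions (suc (suc m))
    step′ (inj₁ pop₁)  (x ∷ y ∷ hs)       = just (inj₁ read₁) , (x , left) ∷ (y , stay) ∷ idle hs
    step′ (inj₁ read₁) (nothing ∷ y ∷ hs) =
      just (inj₁ pop₂) , (nothing , stay) ∷ (y , stay) ∷ idle hs
    step′ (inj₁ read₁) (just x ∷ y ∷ hs)  =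
      just (inj₂ (Fragment.entry F)) , (just x , stay) ∷ (just x , right) ∷ idle hs
    step′ (inj₁ pop₂)  (x ∷ y ∷ hs)       = just (inj₁ read₂) , (x , stay) ∷ (y , left) ∷ idle hs
    step′ (inj₁ read₂) (x ∷ nothing ∷ hs) =
      nothing , (x , stay) ∷ (nothing , stay) ∷ idle hs
    step′ (inj₁ read₂) (x ∷ just y ∷ hs)  =
      just (inj₁ pop₂) , (just y , right) ∷ (just y , stay) ∷ idle hs
    step′ (inj₂ q)     (x ∷ y ∷ hs)       =
      map₁ (just ∘ maybe′ inj₂ (inj₁ pop₁)) (proj₁ (Fragment.δ F q hs) ,
        (x , stay) ∷ (y , stay) ∷ proj₂ (Fragment.δ F q hs))

  compile : ∀ {d} → Prog d → Fragment (width d)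
  compile {d} skip       = single idle
  compile {d} (push i x) = single (λ hs → idle hs [ register d i ]≔ (cell x , right))
  compile {d} (pop i f)  = popF (register d i) (λ x → compile (f x))
  compile (p ⨾ q)        = seqF (compile p) (compile q)
  compile (repeat p)     = repeatF (compile p)

  -- Correctness and running time of compiled programs

  seqF-second : ∀ {m t} (F G : Fragment m) {q ts ts′} →
                Runs G t q ts ts′ → Runs (seqF F G) t (inj₂ q) ts ts′
  seqF-second F G (exit e r)   = exit (cong (map₁ (Maybe.map inj₂)) e) r
  seqF-second F G (next e r s) = next (cong (map₁ (Maybe.map inj₂)) e) r (seqF-second F G s)

  seqF-runs : ∀ {m t u} (F G : Fragment m) {q ts ts′ ts″} →
              Runs F t q ts ts′ → Runs G u (Fragment.entry G) ts′ ts″ →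
              Runs (seqF F G) (t + u) (inj₁ q) ts ts″
  seqF-runs F G (exit e r)   s′ =
    next (cong (map₁ (just ∘ maybe′ inj₁ (inj₂ (Fragment.entry G)))) e) r (seqF-second F G s′)
  seqF-runs F G (next e r s) s′ =
    next (cong (map₁ (just ∘ maybe′ inj₁ (inj₂ (Fragment.entry G)))) e) r (seqF-runs F G s s′)

  popF-inner : ∀ {m t} i (F : Maybe Γ → Fragment m) x {q ts ts′} →
               Runs (F x) t q ts ts′ → Runs (popF i F) t (inj₂ (x , q)) ts ts′
  popF-inner i F x (exit e r)   = exit (cong (map₁ (Maybe.map _)) e) r
  popF-inner i F x (next e r s) = next (cong (map₁ (Maybe.map _)) e) r (popF-inner i F x s)

  popF-runs : ∀ {m t} i (F : Maybe Γ → Fragment m) x {ts ts₁ ts′} →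
              updateAt ts i (move left) ≡ ts₁ →
              decode (Tape.head (lookup ts₁ i)) ≡ x →
              Runs (F x) t (Fragment.entry (F x)) ts₁ ts′ →
              Runs (popF i F) (2 + t) (inj₁ false) ts ts′
  popF-runs i F x {ts} refl refl s =
    next refl (trans (▷-one ts i _) (updateAt-head ts i))
      (next (cong (λ h → just (inj₂ (decode h , Fragment.entry (F (decode h)))) , idle (heads ts₁))
               (lookup-map i Tape.head ts₁))
            (▷-idle ts₁) (popF-inner i F x s))
    where
    ts₁ = updateAt ts i (move left)

    updateAt-head : ∀ {m} (ts : Vec Tp m) i →
      updateAt ts i (writeMove (lookup (heads ts) i , left)) ≡ updateAt ts i (move left)
    updateAt-head (t ∷ ts) zero    = refl
    updateAt-head (t ∷ ts) (suc i) = cong (t ∷_) (updateAt-head ts i)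

  repeatF-body : ∀ {m t u} (F : Fragment m) {q l r ts ts′ ts″} →
                 Runs F t q ts ts′ → Runs (repeatF F) u (inj₁ pop₁) (l ∷ r ∷ ts′) ts″ →
                 Runs (repeatF F) (t + u) (inj₂ q) (l ∷ r ∷ ts) ts″
  repeatF-body F {l = l} {r} (exit e refl)   s′ = next
    (cong (λ z → map₁ (just ∘ maybe′ inj₂ (inj₁ pop₁))
      (proj₁ z , (Tape.head l , stay) ∷ (Tape.head r , stay) ∷ proj₂ z)) e) refl s′
  repeatF-body F {l = l} {r} (next e refl s) s′ = next
    (cong (λ z → map₁ (just ∘ maybe′ inj₂ (inj₁ pop₁))
      (proj₁ z , (Tape.head l , stay) ∷ (Tape.head r , stay) ∷ proj₂ z)) e) refl
    (repeatF-body F s s′)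

  -- A stack is kept on the cells before the head, and whatever is on the other
  -- cells is ignored.
  Represents : List Γ → ∀ d → Vec Tp (width d) → Store (suc k) → Set
  Represents c zero    ts           σ = ∀ i → Tape.before (lookup ts i) ≡ cells (get i σ)
  Represents c (suc d) (l ∷ r ∷ ts) σ =
    Tape.before l ≡ cells c × Tape.before r ≡ [] × Represents c d ts σ

  represents-get : ∀ c d {ts σ} → Represents c d ts σ → ∀ i →
                   Tape.before (lookup ts (register d i)) ≡ cells (get i σ)
  represents-get c zero    rep i = rep i
  represents-get c (suc d) {l ∷ r ∷ ts} (_ , _ , rep) i = represents-get c d rep i

  represents-set : ∀ c d {ts σ} → Represents c d ts σ → ∀ i f xs →
                   Tape.before (f (lookup ts (register d i))) ≡ cells xs →
                   Represents c d (updateAt ts (register d i) f) (set i xs σ)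
  represents-set c zero {ts} {σ} rep i f xs e j with j Fin.≟ i
  ... | yes refl = trans (cong Tape.before (lookup∘updateAt j ts))
                     (trans e (sym (cong cells (get-set j xs σ))))
  ... | no j≢i   = trans (cong Tape.before (lookup∘updateAt′ j i j≢i ts))
                     (trans (rep j) (sym (cong cells (get-set-≢ j i xs σ j≢i))))
  represents-set c (suc d) {l ∷ r ∷ ts} (a , b , rep) i f xs e =
    a , b , represents-set c d rep i f xs e

  -- Only the length of the counter contents c matters; in the machine c is the reversed input, and
  -- all nested loops carry the same c.
  Simulates : ℕ → ∀ {d} → Prog d → ℕ → Set
  Simulates N {d} p bound = ∀ c → List.length c ≡ N → ∀ {σ σ′ ts} → Exec N p σ σ′ →
    Represents c d ts σ → ∃[ t ] ∃[ ts′ ] t ≤ bound ×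
    Runs (compile p) t (Fragment.entry (compile p)) ts ts′ × Represents c d ts′ σ′

  cells-head : ∀ {xs} {t : Tp} → Tape.before t ≡ cells xs →
               decode (Tape.head (move left t)) ≡ List.head xs
  cells-head {[]}     {tape [] _ _}      refl = refl
  cells-head {x ∷ xs} {tape (_ ∷ _) _ _} refl = refl

  cells-tail : ∀ {xs} {t : Tp} → Tape.before t ≡ cells xs →
               Tape.before (move left t) ≡ cells (drop 1 xs)
  cells-tail {[]}     {tape [] _ _}      refl = refl
  cells-tail {x ∷ xs} {tape (_ ∷ _) _ _} refl = refl

  cells-push : ∀ {xs} x (t : Tp) → Tape.before t ≡ cells xs →
               Tape.before (writeMove (cell x , right) t) ≡ cells (x ∷ xs)
  cells-push x (tape _ _ [])      refl = refl
  cells-push x (tape _ _ (_ ∷ _)) refl = refl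

  module _ {d : ℕ} (p : Prog d) where

    private
      F = compile p

    -- Restoring the counter to c lets an enclosing loop run this one again.
    repeatF-rewind : ∀ c ys xs {l r ts σ} → Tape.before l ≡ cells xs → Tape.before r ≡ cells ys →
      ys ʳ++ xs ≡ c → Represents c d ts σ →
      ∃[ ts′ ] Runs (repeatF F) (List.length ys * 2 + 2) (inj₁ pop₂) (l ∷ r ∷ ts) ts′ ×
      Represents c (suc d) ts′ σ
    repeatF-rewind c [] xs {l} {tape [] h rs} {ts} el refl refl rep =
      _ , next refl (cong (λ z → l ∷ tape [] nothing (h ∷ rs) ∷ z) (▷-idle ts))
            (exit refl (cong (λ z → l ∷ tape [] nothing (h ∷ rs) ∷ z) (▷-idle ts))) ,
      (el , refl , rep)
    repeatF-rewind c (y ∷ ys) xs {l} {tape (_ ∷ ls) h rs} {ts} el refl eq rep =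
      let ts′ , runs , rep′ = repeatF-rewind c ys (y ∷ xs) (cells-push y l el) refl eq rep
      in ts′ , next refl (cong (λ z → l ∷ tape ls (cell y) (h ∷ rs) ∷ z) (▷-idle ts))
                 (next refl (cong (λ z → writeMove (cell y , right) l ∷
                                          tape ls (cell y) (h ∷ rs) ∷ z)
                                  (▷-idle ts)) runs) , rep′

    -- Moving symbols between stacks reverses them, hence `reverse c` in the invariant; the rewind
    -- reverses once more. In the summand `4 + N * 2`, two steps find the first counter tape empty,
    -- two find the second one empty, and each rewound symbol takes two.
    repeatF-loop : ∀ {N B} → Simulates N p B → ∀ c → List.length c ≡ N →
      ∀ xs ys {l r ts σ σ′} → Tape.before l ≡ cells xs → Tape.before r ≡ cells ys →
      xs ʳ++ ys ≡ reverse c → Represents c d ts σ → Iter (Exec N p) (List.length xs) σ σ′ →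
      ∃[ t ] ∃[ ts′ ] t ≤ List.length xs * (2 + B) + (4 + N * 2) ×
      Runs (repeatF F) t (inj₁ pop₁) (l ∷ r ∷ ts) ts′ × Represents c (suc d) ts′ σ′
    repeatF-loop {N} {B} sim c len [] ys {tape [] h rs} {r} {ts} refl er eq rep [] =
      let ts′ , runs , rep′ = repeatF-rewind c ys [] {tape [] nothing (h ∷ rs)} refl er
            (trans (cong reverse eq) (reverse-involutive c)) rep
      in 2 + (List.length ys * 2 + 2) , ts′ ,
         ≤-reflexive (trans (cong (λ m → 2 + (m * 2 + 2))
           (trans (cong List.length eq) (trans (length-reverse c) len)))
           (cong (2 +_) (+-comm (N * 2) 2))) ,
         next refl (cong (λ z → tape [] nothing (h ∷ rs) ∷ r ∷ z) (▷-idle ts))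
           (next refl (cong (λ z → tape [] nothing (h ∷ rs) ∷ r ∷ z) (▷-idle ts)) runs) , rep′
    repeatF-loop {N} {B} sim c len (x ∷ xs) ys {tape (_ ∷ ls) h rs} {r} {ts}
                 refl er eq rep (e ∷ es) =
      let t , ts₁ , t≤ , runs , rep₁ = sim c len e rep
          u , ts₂ , u≤ , runs′ , rep₂ =
            repeatF-loop sim c len xs (x ∷ ys) {tape ls (cell x) (h ∷ rs)}
              refl (cells-push x r er) eq rep₁ es
      in 2 + (t + u) , ts₂ ,
         ≤-trans (+-monoʳ-≤ 2 (+-mono-≤ t≤ u≤))
           (≤-reflexive (sym (trans (+-assoc (2 + B) _ _) (+-assoc 2 B _)))) ,
         next refl (cong (λ z → tape ls (cell x) (h ∷ rs) ∷ r ∷ z) (▷-idle ts))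
           (next refl (cong (λ z → tape ls (cell x) (h ∷ rs) ∷ writeMove (cell x , right) r ∷ z)
                            (▷-idle ts))
             (repeatF-body F runs runs′)) , rep₂

  1≤^ : ∀ N d → 1 ≤ suc N ^ d
  1≤^ N d = m^n>0 (suc N) d

  -- Constant overheads are absorbed into the coefficient because `suc N ^ d` is at least 1; bounds
  -- are in `suc N` rather than N to have this for N = 0 too.
  bound-step : ∀ m b N d → m + b * suc N ^ d ≤ (m + b) * suc N ^ d
  bound-step m b N d = ≤-trans
    (+-monoˡ-≤ (b * suc N ^ d)
      (≤-trans (≤-reflexive (sym (*-identityʳ m))) (*-monoʳ-≤ m (1≤^ N d))))
    (≤-reflexive (sym (*-distribʳ-+ (suc N ^ d) m b)))

  -- A counter symbol costs two steps when its iteration starts and two when it is rewound, hence 4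
  -- per iteration. The 4 remaining steps are paid by passing from N to `suc N` factors.
  repeat-bound : ∀ N b d → N * (2 + b * suc N ^ d) + (4 + N * 2) ≤ (4 + b) * suc N ^ suc d
  repeat-bound N b d = begin
    N * (2 + b * s) + (4 + N * 2)  ≡⟨ solve 2 (λ n e → n :* (con 2 :+ e) :+ (con 4 :+ n :* con 2) :=
                                        con 4 :+ n :* (con 4 :+ e)) refl N (b * s) ⟩
    4 + N * (4 + b * s)            ≤⟨ +-monoˡ-≤ _ (m≤m+n 4 (b * s)) ⟩
    suc N * (4 + b * s)            ≤⟨ *-monoʳ-≤ (suc N) (bound-step 4 b N d) ⟩
    suc N * ((4 + b) * s)          ≡⟨ solve 3 (λ m e s → m :* (e :* s) := e :* (m :* s))
                                        refl (suc N) (4 + b) s ⟩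
    (4 + b) * (suc N * s)          ∎
    where
    open ≤-Reasoning
    open +-*-Solver
    s = suc N ^ d

  -- The coefficient is chosen before N: it depends on the text of the program alone, so the bound
  -- is uniform over all inputs.
  simulate : ∀ {d} (p : Prog d) → ∃[ b ] (∀ N → Simulates N p (b * suc N ^ d))
  simulate {d} skip = 1 , λ { N c len {ts = ts} skip rep →
    1 , ts , ≤-trans (1≤^ N d) (m≤m+n _ 0) , exit refl (▷-idle ts) , rep }
  simulate {d} (push i x) = 1 , λ { N c len {ts = ts} push rep →
    1 , _ , ≤-trans (1≤^ N d) (m≤m+n _ 0) ,
    exit refl (▷-one ts (register d i) (cell x , right)) ,
    represents-set c d rep i _ _
      (cells-push x (lookup ts (register d i)) (represents-get c d rep i)) }
  simulate {d} (pop i f) =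
    let b , f≤b = finite-bounded (Maybe-finite Γ-finite) (λ x → proj₁ (simulate (f x)))
    in 2 + b , λ { N c len {σ = σ} {ts = ts} (pop e) rep →
      let x = List.head (get i σ)
          before≡ = represents-get c d rep i
          t , ts′ , t≤ , runs , rep′ = proj₂ (simulate (f x)) N c len e
            (represents-set c d rep i (move left) (drop 1 (get i σ))
              (cells-tail {get i σ} before≡))
      in 2 + t , ts′ ,
         ≤-trans (+-monoʳ-≤ 2 (≤-trans t≤ (*-monoˡ-≤ (suc N ^ d) (f≤b x)))) (bound-step 2 b N d) ,
         popF-runs (register d i) (λ x → compile (f x)) x refl
           (trans (cong (decode ∘ Tape.head) (lookup∘updateAt (register d i) ts))
                  (cells-head {get i σ} before≡))
           runs , rep′ }
  simulate {d} (p ⨾ q) =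
    let b , sim = simulate p
        b′ , sim′ = simulate q
    in b + b′ , λ { N c len (e ⨾ e′) rep →
      let t , ts₁ , t≤ , runs , rep₁ = sim N c len e rep
          u , ts₂ , u≤ , runs′ , rep₂ = sim′ N c len e′ rep₁
      in t + u , ts₂ ,
         ≤-trans (+-mono-≤ t≤ u≤) (≤-reflexive (sym (*-distribʳ-+ (suc N ^ d) b b′))) ,
         seqF-runs (compile p) (compile q) runs runs′ , rep₂ }
  simulate {suc d} (repeat p) =
    let b , sim = simulate p
    in 4 + b , λ { N c refl {ts = l ∷ r ∷ ts} (repeat es) (el , er , rep) →
      let t , ts′ , t≤ , runs , rep′ = repeatF-loop p (sim N) c refl c [] el er refl rep es
      in t , ts′ , ≤-trans t≤ (repeat-bound N b d) , runs , rep′ }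

  -- The deciding machine: loading, running, reading the answer

  module Decider {d : ℕ} (p : Prog d) (out : Fin (suc k)) (accept : Maybe Γ → Bool) where

    private
      F = compile p

    data Ends : Set where
      load popOut readOut : Ends

    Ends-finite : Finite Ends
    Ends-finite = ↔-finite (mk↔ₛ′ to from to∘from from∘to) (Fin-finite 3)
      where
      to : Ends → Fin 3
      to load    = zero
      to popOut  = suc zero
      to readOut = suc (suc zero)

      from : Fin 3 → Ends
      from zero          = load
      from (suc zero)    = popOut
      from (suc (suc _)) = readOut

      to∘from : ∀ i → to (from i) ≡ i
      to∘from zero             = refl
      to∘from (suc zero)       = refl
      to∘from (suc (suc zero)) = refl

      from∘to : ∀ q → from (to q) ≡ q
      from∘to load    = refl
      from∘to popOut  = refl
      from∘to readOut = refl

    -- Every input symbol is copied to register 0 and to all the counters.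
    loadActions : Γ → ∀ e → Vec Sym (width e) → Actions (width e)
    loadActions x zero    (h ∷ hs)     = (cell x , right) ∷ idle hs
    loadActions x (suc e) (h ∷ g ∷ hs) = (cell x , right) ∷ (g , stay) ∷ loadActions x e hs

    Control = (Ends ⊎ Bool) ⊎ Fragment.Q F

    δ : Control → Vec Sym (suc (width d)) → Control × Actions (suc (width d))
    δ (inj₁ (inj₁ load))    (nothing ∷ hs)       =
      inj₂ (Fragment.entry F) , (nothing , stay) ∷ idle hs
    δ (inj₁ (inj₁ load))    (just (inj₁ x) ∷ hs) =
      inj₁ (inj₁ load) , (cell x , right) ∷ loadActions x d hs
    δ (inj₁ (inj₁ popOut))  (h ∷ hs)             = inj₁ (inj₁ readOut) ,
      (h , stay) ∷ (idle hs [ register d out ]≔ (lookup hs (register d out) , left))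
    δ (inj₁ (inj₁ readOut)) (h ∷ hs)             =
      inj₁ (inj₂ (accept (decode (lookup hs (register d out))))) , (h , stay) ∷ idle hs
    δ (inj₁ (inj₂ b))       (h ∷ hs)             = inj₁ (inj₂ b) , (h , stay) ∷ idle hs
    δ (inj₂ q)              (h ∷ hs)             =
      maybe′ inj₂ (inj₁ (inj₁ popOut)) (proj₁ (Fragment.δ F q hs)) ,
      (h , stay) ∷ proj₂ (Fragment.δ F q hs)

    verdict : Control → Maybe Bool
    verdict (inj₁ (inj₂ b)) = just b
    verdict (inj₁ (inj₁ _)) = nothing
    verdict (inj₂ _)        = nothing

    machine : TuringMachine Γ
    machine = record
      { Control     = Control
      ; Auxiliary   = Fin 0
      ; control-fin = ⊎-finite (⊎-finite Ends-finite Bool-finite) (Fragment.finite F)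
      ; aux-fin     = Fin-finite 0
      ; extraTapes  = width d
      ; start       = inj₁ (inj₁ load)
      ; verdict     = verdict
      ; δ           = δ
      }

    open TuringMachine machine using (Configuration; run; step; initial; HaltsWithin)

    run-+ : ∀ m m′ c → run (m + m′) c ≡ run m′ (run m c)
    run-+ zero    m′ c = refl
    run-+ (suc m) m′ c = run-+ m m′ (step c)

    run-body : ∀ {t q ts ts′} u → Runs F t q ts ts′ →
               run t (inj₂ q , u ∷ ts) ≡ (inj₁ (inj₁ popOut) , u ∷ ts′)
    run-body u (exit e refl) rewrite e = refl
    run-body u (next e refl runs) rewrite e = run-body u runs

    scan : List Sym → List Γ → Tp
    scan ls []       = tape ls nothing []
    scan ls (x ∷ xs) = tape ls (cell x) (cells xs)

    scan-right : ∀ ls x xs → writeMove (cell x , right) (scan ls (x ∷ xs)) ≡ scan (cell x ∷ ls) xs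
    scan-right ls x []       = refl
    scan-right ls x (y ∷ xs) = refl

    represents-load : ∀ x c e {ts} → Represents c e ts (set zero c (empty (suc k))) →
      Represents (x ∷ c) e (ts ▷ loadActions x e (heads ts)) (set zero (x ∷ c) (empty (suc k)))
    represents-load x c zero {t ∷ ts} rep zero    = cells-push x t (rep zero)
    represents-load x c zero {t ∷ ts} rep (suc i) =
      trans (cong (λ us → Tape.before (lookup us i)) (▷-idle ts)) (rep (suc i))
    represents-load x c (suc e) {l ∷ r ∷ ts} (el , er , rep) =
      cells-push x l el , er , represents-load x c e rep

    -- One step per symbol and one on the blank that ends the word, hence `suc`. The last symbol
    -- read ends on top, so register 0 and the counters receive the word reversed.
    run-load : ∀ ls xs c {ts} → Represents c d ts (set zero c (empty (suc k))) →
      ∃[ u ] ∃[ ts′ ]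
      run (suc (List.length xs)) (inj₁ (inj₁ load) , scan ls xs ∷ ts) ≡
        (inj₂ (Fragment.entry F) , u ∷ ts′) ×
      Represents (xs ʳ++ c) d ts′ (set zero (xs ʳ++ c) (empty (suc k)))
    run-load ls [] c {ts} rep =
      _ , ts , cong (λ us → inj₂ (Fragment.entry F) , tape ls nothing [] ∷ us) (▷-idle ts) , rep
    run-load ls (x ∷ xs) c {ts} rep rewrite scan-right ls x xs =
      run-load (cell x ∷ ls) xs (x ∷ c) (represents-load x c d rep)

    represents-blank : ∀ e →
      Represents [] e (Vec.replicate (width e) (fromWord [])) (set zero [] (empty (suc k)))
    represents-blank zero    zero    = refl
    represents-blank zero    (suc i) = trans (cong Tape.before (lookup-replicate i (fromWord [])))
      (cong cells (sym (get-empty k i)))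
    represents-blank (suc e) = refl , refl , represents-blank e

    fromWord-scan : ∀ w → fromWord (List.map inj₁ w) ≡ scan [] w
    fromWord-scan []       = refl
    fromWord-scan (x ∷ xs) = cong (tape [] (cell x)) (sym (map-∘ xs))

    -- One unit pays for the `suc N` loading steps and two pay for the pop and the read of the
    -- answer.
    bound : ℕ
    bound = 3 + proj₁ (simulate p)

    -- The exponent is one more than the nesting depth so that loading, which is linear, is also
    -- covered when the program has no loop.
    halts : ∀ w {σ} → Exec (List.length w) p (set zero (reverse w) (empty (suc k))) σ →
      HaltsWithin (bound * suc (List.length w) ^ suc d) w (accept (List.head (get out σ)))
    halts w {σ} e = m , m≤ , cong verdict run-m
      where
      N = List.length w
      s = suc N ^ d
      b = proj₁ (simulate p)

      loaded = run-load [] w [] (represents-blank d)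
      u₁     = proj₁ loaded
      ts₁    = proj₁ (proj₂ loaded)

      simulated = proj₂ (simulate p) N (reverse w) (length-reverse w) e
                    (proj₂ (proj₂ (proj₂ loaded)))
      t   = proj₁ simulated
      ts₂ = proj₁ (proj₂ simulated)
      t≤  = proj₁ (proj₂ (proj₂ simulated))
      runs = proj₁ (proj₂ (proj₂ (proj₂ simulated)))
      rep₂ = proj₂ (proj₂ (proj₂ (proj₂ simulated)))

      i = register d out
      m = suc N + (t + 2)

      a   = lookup (heads ts₂) i , left
      ts₃ = updateAt ts₂ i (writeMove a)

      read : decode (lookup (heads (ts₂ ▷ (idle (heads ts₂) [ i ]≔ a))) i) ≡ List.head (get out σ)
      read = trans (cong (λ us → decode (lookup (heads us) i)) (▷-one ts₂ i a))
        (trans (cong decode (lookup-map i Tape.head ts₃))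
        (trans (cong (decode ∘ Tape.head) (lookup∘updateAt i {f = writeMove a} ts₂))
        (trans (cong (λ h → decode (Tape.head (writeMove (h , left) (lookup ts₂ i))))
                     (lookup-map i Tape.head ts₂))
               (cells-head {get out σ} (represents-get (reverse w) d rep₂ out)))))

      blank : Vec Tp (width d)
      blank = Vec.replicate (width d) (fromWord [])

      c₀ c₁ c₂ : Configuration
      c₀ = inj₁ (inj₁ load) , scan [] w ∷ blank
      c₁ = inj₂ (Fragment.entry F) , u₁ ∷ ts₁
      c₂ = inj₁ (inj₁ popOut) , u₁ ∷ ts₂

      run-m : proj₁ (run m (initial w)) ≡ inj₁ (inj₂ (accept (List.head (get out σ))))
      run-m = begin
        proj₁ (run m (initial w))
          ≡⟨ cong (λ v → proj₁ (run m (inj₁ (inj₁ load) , v ∷ blank))) (fromWord-scan w) ⟩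
        proj₁ (run m c₀)
          ≡⟨ cong proj₁ (run-+ (suc N) (t + 2) c₀) ⟩
        proj₁ (run (t + 2) (run (suc N) c₀))
          ≡⟨ cong (proj₁ ∘ run (t + 2)) (proj₁ (proj₂ (proj₂ loaded))) ⟩
        proj₁ (run (t + 2) c₁)
          ≡⟨ cong proj₁ (run-+ t 2 c₁) ⟩
        proj₁ (run 2 (run t c₁))
          ≡⟨ cong (proj₁ ∘ run 2) (run-body u₁ runs) ⟩
        proj₁ (run 2 c₂)
          ≡⟨ cong (λ x → inj₁ (inj₂ (accept x))) read ⟩
        inj₁ (inj₂ (accept (List.head (get out σ)))) ∎
        where open ≡-Reasoning

      m≤ : m ≤ bound * suc N ^ suc d
      m≤ = begin
        suc N + (t + 2)
          ≤⟨ +-monoʳ-≤ (suc N) (+-monoˡ-≤ 2 t≤) ⟩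
        suc N + (b * s + 2)
          ≡⟨ cong (suc N +_) (+-comm (b * s) 2) ⟩
        suc N + (2 + b * s)
          ≤⟨ +-monoʳ-≤ (suc N) (bound-step 2 b N d) ⟩
        suc N + (2 + b) * s
          ≤⟨ +-mono-≤ (m≤m*n (suc N) s ⦃ m^n≢0 (suc N) d ⦄)
                      (m≤m+n ((2 + b) * s) (N * ((2 + b) * s))) ⟩
        suc N * s + suc N * ((2 + b) * s)
          ≡⟨ solve 3 (λ n s c → n :* s :+ n :* (c :* s) := (con 1 :+ c) :* (n :* s))
               refl (suc N) s (2 + b) ⟩
        bound * (suc N * s) ∎
        where
        open ≤-Reasoning
        open +-*-Solver

-- Register 0 is a scratch register, empty between operations.
module Operations (n : ℕ) (k : ℕ) where

  open Stacks (Token n) (suc k)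

  infix 4 _≠_

  -- For distinct concrete registers this computes to the unit type, so Agda fills in the implicit
  -- arguments of this type by itself.
  _≠_ : Fin (suc k) → Fin (suc k) → Set
  i ≠ j = False (i Fin.≟ j)

  -- An empty stack is answered by `skip`; this makes the surplus iterations of a loop harmless.
  onJust : ∀ {d} → (Token n → Prog d) → Maybe (Token n) → Prog d
  onJust f = maybe′ f skip

  bitOr : ∀ {A : Set} → A → (Bool → A) → Token n → A
  bitOr z f (bit b) = f b
  bitOr z f _       = z

  popBit : ∀ {d} → Fin (suc k) → (Bool → Prog d) → Prog d
  popBit i f = pop i (onJust (bitOr skip f))

  clear : ∀ {d} → Fin (suc k) → Prog (suc d)
  clear i = repeat (pop i (λ _ → skip))

  move→ : ∀ {d} → Fin (suc k) → Fin (suc k) → Prog (suc d)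
  move→ i j = repeat (pop i (onJust (push j)))

  -- One pass between stacks reverses the order, so two passes are made; the second one rebuilds the
  -- original while it writes the copy.
  copyWith : ∀ {d} → (Token n → Token n) → Fin (suc k) → Fin (suc k) → Prog (suc d)
  copyWith h i j = move→ i zero ⨾ repeat (pop zero (onJust (λ x → push i x ⨾ push j (h x))))

  -- The loop cannot be left early. Instead the stopping symbol is pushed back whenever it is met,
  -- so that the surplus iterations pop and push it in place; it is removed once afterwards.
  takeUntil : ∀ {d} → (Token n → Bool) → Fin (suc k) → Fin (suc k) → Prog (suc d)
  takeUntil stop i j =
    repeat (pop i (onJust (λ x → if stop x then push i x else push zero x))) ⨾
    pop i (λ _ → skip) ⨾
    move→ zero j

  store : ∀ {d} → Fin (suc k) → Fin (suc k) → Prog (suc d)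
  store i j = push j comma ⨾ move→ i zero ⨾ move→ zero j

  combine : ∀ {d} → (Bool → Bool → Bool) → Fin (suc k) → Fin (suc k) → Prog (suc d)
  combine op i j =
    repeat (popBit i (λ b → popBit j (λ c → push zero (bit (op b c))))) ⨾ move→ zero i

  bits : ∀ {Y : Set} → (Y → Bool) → List Y → List (Token n)
  bits f = map (bit ∘ f)

  -- Effect of the operations on the store

  module Semantics (N : ℕ) where

    cast : ∀ {d} {p : Prog d} {σ τ τ′} → Exec N p σ τ → τ ≡ τ′ → Exec N p σ τ′
    cast e refl = e

    castˡ : ∀ {d} {p : Prog d} {σ σ′ τ} → σ ≡ σ′ → Exec N p σ′ τ → Exec N p σ τ
    castˡ refl e = e

    pop-≡ : ∀ {d i} {f : Maybe (Token n) → Prog d} {σ τ xs} → get i σ ≡ xs →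
            Exec N (f (List.head xs)) (set i (drop 1 xs) σ) τ → Exec N (pop i f) σ τ
    pop-≡ refl e = pop e

    push-≡ : ∀ {d i x} {σ τ} → set i (x ∷ get i σ) σ ≡ τ → Exec N {d} (push i x) σ τ
    push-≡ refl = push

    module _ {Y A : Set} {S : Set} {R : S → S → Set} (I : List Y → A → S) (g : A → Y → A)
      (step : ∀ y ys a → R (I (y ∷ ys) a) (I ys (g a y)))
      (done : ∀ a → R (I [] a) (I [] a)) where

      iterate : ∀ m ys a → List.length ys ≤ m → Iter R m (I ys a) (I [] (foldl g a ys))
      iterate zero    []       a _       = []
      iterate (suc m) []       a _       = done a ∷ iterate m [] a z≤n
      iterate (suc m) (y ∷ ys) a (s≤s l) = step y ys a ∷ iterate m ys (g a y) l

    -- Since the body runs N times and not once per element, the invariant must also be preserved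
    -- when the list is used up. Then N only has to be at least the length of the list, and the
    -- result is that of a left fold.
    loop : ∀ {Y A : Set} {d} {p : Prog d} (I : List Y → A → Store (suc k)) (g : A → Y → A) →
      (∀ y ys a → Exec N p (I (y ∷ ys) a) (I ys (g a y))) →
      (∀ a → Exec N p (I [] a) (I [] a)) →
      ∀ ys a → List.length ys ≤ N → Exec N (repeat p) (I ys a) (I [] (foldl g a ys))
    loop I g step done ys a l = repeat (iterate I g step done N ys a l)

    set-same : ∀ (i : Fin (suc k)) {xs} σ → get i σ ≡ xs → set i xs σ ≡ σ
    set-same i σ refl = set-get i σ

    set-under : ∀ (i j : Fin (suc k)) x y z σ → i ≢ j →
                set i x (set j y (set i z σ)) ≡ set j y (set i x σ)
    set-under i j x y z σ i≢j = trans (set-comm i j x y _ i≢j) (cong (set j y) (set-set i x z σ))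

    clear-exec : ∀ {d} i σ → List.length (get i σ) ≤ N → Exec N (clear {d} i) σ (set i [] σ)
    clear-exec i σ l = castˡ (sym (set-get i σ))
      (loop (λ xs (_ : ℕ) → set i xs σ) (λ a _ → a)
        (λ y ys _ → pop-≡ (get-set i (y ∷ ys) σ) (castˡ (set-set i ys (y ∷ ys) σ) skip))
        (λ _ → pop-≡ (get-set i [] σ) (castˡ (set-set i [] [] σ) skip))
        (get i σ) 0 l)

    move-exec′ : ∀ {d} i j {σ} → i ≢ j → List.length (get i σ) ≤ N →
      Exec N (move→ {d} i j) σ (set i [] (set j (get i σ ʳ++ get j σ) σ))
    move-exec′ i j {σ} i≢j l =
      castˡ (sym (trans (cong (set i (get i σ)) (set-get j σ)) (set-get i σ)))
        (loop (λ xs ys → set i xs (set j ys σ)) (λ a y → y ∷ a)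
          (λ y ys a → pop-≡ (get-set i (y ∷ ys) _) (push-≡ (begin
            set j (y ∷ get j (set i ys (set i (y ∷ ys) (set j a σ))))
                  (set i ys (set i (y ∷ ys) (set j a σ)))
              ≡⟨ cong (λ τ → set j (y ∷ get j τ) τ) (set-set i ys (y ∷ ys) _) ⟩
            set j (y ∷ get j (set i ys (set j a σ))) (set i ys (set j a σ))
              ≡⟨ cong (λ as → set j (y ∷ as) (set i ys (set j a σ)))
                   (trans (get-set-≢ j i ys _ (i≢j ∘ sym)) (get-set j a σ)) ⟩
            set j (y ∷ a) (set i ys (set j a σ))
              ≡⟨ set-under j i (y ∷ a) ys a σ (i≢j ∘ sym) ⟩
            set i ys (set j (y ∷ a) σ) ∎)))
          (λ a → pop-≡ (get-set i [] _) (castˡ (set-set i [] [] _) skip))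
          (get i σ) (get j σ) l)
      where open ≡-Reasoning

    move-exec : ∀ {d} i j {σ} {_ : i ≠ j} → List.length (get i σ) ≤ N →
      Exec N (move→ {d} i j) σ (set i [] (set j (get i σ ʳ++ get j σ) σ))
    move-exec i j {_} {i#j} = move-exec′ i j (toWitnessFalse i#j)

    foldl-pair : ∀ (h : Token n → Token n) ys as bs →
      foldl (λ { (as , bs) y → y ∷ as , h y ∷ bs }) (as , bs) ys ≡ (ys ʳ++ as , map h ys ʳ++ bs)
    foldl-pair h []       as bs = refl
    foldl-pair h (y ∷ ys) as bs = foldl-pair h ys (y ∷ as) (h y ∷ bs)

    reverse-length≤ : ∀ {A : Set} {xs : List A} {m} →
      List.length xs ≤ m → List.length (reverse xs) ≤ m
    reverse-length≤ {xs = xs} = subst (_≤ _) (sym (length-reverse xs))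

    copyWith-exec : ∀ {d} h i j {σ} {_ : i ≠ zero} {_ : j ≠ zero} {_ : i ≠ j} →
      get zero σ ≡ [] → get j σ ≡ [] → List.length (get i σ) ≤ N →
      Exec N (copyWith {d} h i j) σ (set j (map h (get i σ)) σ)
    copyWith-exec h i j {σ@(_ , _)} {i#0} {j#0} {i#j} t≡ j≡ l =
      cast (move-exec′ i zero i≢0 l) (begin
          set i [] (set zero (xs ʳ++ get zero σ) σ)
            ≡⟨ cong (λ ys → set i [] (set zero (xs ʳ++ ys) σ)) t≡ ⟩
          set i [] (set zero (reverse xs) σ)
            ≡⟨ set-comm i zero [] (reverse xs) σ i≢0 ⟩
          set zero (reverse xs) (set i [] σ)
            ≡⟨ cong (λ τ → set zero (reverse xs) (set i [] τ)) (sym (set-same j σ j≡)) ⟩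
          I (reverse xs) ([] , []) ∎) ⨾
      cast (loop I (λ { (as , bs) y → y ∷ as , h y ∷ bs })
        (λ { y ys (as , bs) → pop-≡ (get-set zero (y ∷ ys) (set i as (set j bs σ)))
          (castˡ (set-set zero ys (y ∷ ys) (set i as (set j bs σ)))
          ( push-≡ (trans (cong (λ zs → set i (y ∷ zs) (I ys (as , bs)))
                      (trans (get-set-≢ i zero ys _ i≢0) (get-set i as _)))
                    (set-under i zero (y ∷ as) ys as _ i≢0))
          ⨾ push-≡ (begin
              set j (h y ∷ get j (I ys (y ∷ as , bs))) (I ys (y ∷ as , bs))
                ≡⟨ cong (λ zs → set j (h y ∷ zs) (I ys (y ∷ as , bs)))
                     (trans (get-set-≢ j zero ys _ j≢0)
                       (trans (get-set-≢ j i (y ∷ as) _ (i≢j ∘ sym)) (get-set j bs σ))) ⟩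
              set j (h y ∷ bs) (I ys (y ∷ as , bs))
                ≡⟨ set-comm j zero (h y ∷ bs) ys _ j≢0 ⟩
              set zero ys (set j (h y ∷ bs) (set i (y ∷ as) (set j bs σ)))
                ≡⟨ cong (set zero ys) (set-under j i (h y ∷ bs) (y ∷ as) bs σ (i≢j ∘ sym)) ⟩
              I ys (y ∷ as , h y ∷ bs) ∎))) })
        (λ (as , bs) → pop-≡ (get-set zero [] (set i as (set j bs σ)))
          (castˡ (set-set zero [] [] (set i as (set j bs σ))) skip))
        (reverse xs) ([] , []) (reverse-length≤ {xs = xs} l))
        (begin
          I [] (foldl _ ([] , []) (reverse xs))
            ≡⟨ cong (I []) (foldl-pair h (reverse xs) [] []) ⟩
          I [] (reverse (reverse xs) , reverse (map h (reverse xs)))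
            ≡⟨ cong (I []) (cong₂ _,_ (reverse-involutive xs)
                 (trans (cong reverse (reverse-map h xs)) (reverse-involutive (map h xs)))) ⟩
          set zero [] (set i xs (set j (map h xs) σ))
            ≡⟨ set-comm zero i [] xs _ (i≢0 ∘ sym) ⟩
          set i xs (set zero [] (set j (map h xs) σ))
            ≡⟨ cong (set i xs) (set-comm zero j [] (map h xs) σ (j≢0 ∘ sym)) ⟩
          set i xs (set j (map h xs) (set zero [] σ))
            ≡⟨ cong (λ τ → set i xs (set j (map h xs) τ)) (set-same zero σ t≡) ⟩
          set i xs (set j (map h xs) σ)
            ≡⟨ set-comm i j xs (map h xs) σ i≢j ⟩
          set j (map h xs) (set i xs σ)
            ≡⟨ cong (set j (map h xs)) (set-get i σ) ⟩
          set j (map h xs) σ ∎)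
      where
      open ≡-Reasoning
      i≢0 = toWitnessFalse i#0
      j≢0 = toWitnessFalse j#0
      i≢j = toWitnessFalse i#j
      xs = get i σ

      I : List (Token n) → List (Token n) × List (Token n) → Store (suc k)
      I ys (as , bs) = set zero ys (set i as (set j bs σ))

    copy-exec : ∀ {d} i j {σ} {_ : i ≠ zero} {_ : j ≠ zero} {_ : i ≠ j} →
      get zero σ ≡ [] → get j σ ≡ [] → List.length (get i σ) ≤ N →
      Exec N (copyWith {d} id i j) σ (set j (get i σ) σ)
    copy-exec i j {σ} {i#0} {j#0} {i#j} t≡ j≡ l =
      cast (copyWith-exec id i j {_} {i#0} {j#0} {i#j} t≡ j≡ l)
           (cong (λ ys → set j ys σ) (map-id (get i σ)))

    reverse-ʳ++ : ∀ {A : Set} (xs ys : List A) → reverse xs ʳ++ ys ≡ xs ++ ys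
    reverse-ʳ++ xs ys = trans (ʳ++-defn (reverse xs)) (cong (_++ ys) (reverse-involutive xs))

    store-exec : ∀ {d} i j {σ} {_ : i ≠ zero} {_ : j ≠ zero} {_ : i ≠ j} →
      get zero σ ≡ [] → List.length (get i σ) ≤ N →
      Exec N (store {d} i j) σ (set i [] (set j (get i σ ++ comma ∷ get j σ) σ))
    store-exec i j {σ@(_ , _)} {i#0} {j#0} {i#j} t≡ l =
      push ⨾
      castˡ refl (cast (move-exec′ i zero i≢0 (subst (λ ys → List.length ys ≤ N) (sym gi) l)) (begin
        set i [] (set zero (get i σ₁ ʳ++ get zero σ₁) σ₁)
          ≡⟨ cong (λ ys → set i [] (set zero ys σ₁))
               (cong₂ _ʳ++_ gi (trans (get-set-≢ zero j _ σ (j≢0 ∘ sym)) t≡)) ⟩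
        set i [] (set zero (reverse xs) σ₁)
          ≡⟨ set-comm i zero [] (reverse xs) σ₁ i≢0 ⟩
        set zero (reverse xs) (set i [] σ₁) ∎)) ⨾
      cast (move-exec′ zero j (j≢0 ∘ sym) (reverse-length≤ {xs = xs} l)) (begin
        set zero [] (set j (reverse xs ʳ++ get j σ₂) σ₂)
          ≡⟨ cong (λ ys → set zero [] (set j ys σ₂)) (trans (reverse-ʳ++ xs _) (cong (xs ++_)
               (trans (get-set-≢ j zero _ _ j≢0)
                 (trans (get-set-≢ j i [] σ₁ (i≢j ∘ sym)) (get-set j _ σ))))) ⟩
        set zero [] (set j ys (set zero (reverse xs) (set i [] σ₁)))
          ≡⟨ set-under zero j [] ys (reverse xs) (set i [] σ₁) (j≢0 ∘ sym) ⟩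
        set j ys (set zero [] (set i [] (set j (comma ∷ get j σ) σ)))
          ≡⟨ cong (set j ys) (set-comm zero i [] [] _ (i≢0 ∘ sym)) ⟩
        set j ys (set i [] (set zero [] (set j (comma ∷ get j σ) σ)))
          ≡⟨ cong (λ τ → set j ys (set i [] τ))
               (set-same zero σ₁ (trans (get-set-≢ zero j _ σ (j≢0 ∘ sym)) t≡)) ⟩
        set j ys (set i [] (set j (comma ∷ get j σ) σ))
          ≡⟨ set-under j i ys [] _ σ (i≢j ∘ sym) ⟩
        set i [] (set j ys σ) ∎)
      where
      open ≡-Reasoning
      i≢0 = toWitnessFalse i#0
      j≢0 = toWitnessFalse j#0
      i≢j = toWitnessFalse i#j
      xs = get i σ
      ys = xs ++ comma ∷ get j σ
      σ₁ = set j (comma ∷ get j σ) σ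
      σ₂ = set zero (reverse xs) (set i [] σ₁)
      gi : get i σ₁ ≡ xs
      gi = get-set-≢ i j _ σ i≢j

    takeUntil-exec : ∀ {d} (stop : Token n → Bool) i j {σ}
      {_ : i ≠ zero} {_ : j ≠ zero} {_ : i ≠ j} {xs s rest} →
      All (λ x → stop x ≡ false) xs → stop s ≡ true → get i σ ≡ xs ++ s ∷ rest →
      get zero σ ≡ [] → get j σ ≡ [] → List.length xs ≤ N →
      Exec N (takeUntil {d} stop i j) σ (set i rest (set j xs σ))
    takeUntil-exec stop i j {σ@(_ , _)} {i#0} {j#0} {i#j} {xs} {s} {rest} go halt i≡ t≡ j≡ l =
      castˡ (trans (sym (set-same i σ i≡))
                   (cong (set i (xs ++ s ∷ rest)) (sym (set-same zero σ t≡))))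
        (repeat (scan N xs [] go l)) ⨾
      pop-≡ (get-set i (s ∷ rest) _) (castˡ (set-set i rest (s ∷ rest) _) skip) ⨾
      cast (move-exec′ zero j (j≢0 ∘ sym) (subst (λ ys → List.length ys ≤ N)
             (sym (trans (get-set-≢ zero i rest _ (i≢0 ∘ sym)) (get-set zero (reverse xs) σ)))
             (reverse-length≤ {xs = xs} l))) (begin
        set zero [] (set j (get zero σ₁ ʳ++ get j σ₁) σ₁)
          ≡⟨ cong (λ ys → set zero [] (set j ys σ₁)) (trans (cong₂ _ʳ++_
               (trans (get-set-≢ zero i rest _ (i≢0 ∘ sym)) (get-set zero (reverse xs) σ))
               (trans (get-set-≢ j i rest _ (i≢j ∘ sym)) (trans (get-set-≢ j zero _ σ j≢0) j≡)))
               (reverse-involutive xs)) ⟩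
        set zero [] (set j xs (set i rest (set zero (reverse xs) σ)))
          ≡⟨ set-comm zero j [] xs _ (j≢0 ∘ sym) ⟩
        set j xs (set zero [] (set i rest (set zero (reverse xs) σ)))
          ≡⟨ cong (set j xs) (set-under zero i [] rest (reverse xs) σ (i≢0 ∘ sym)) ⟩
        set j xs (set i rest (set zero [] σ))
          ≡⟨ cong (λ τ → set j xs (set i rest τ)) (set-same zero σ t≡) ⟩
        set j xs (set i rest σ)
          ≡⟨ set-comm j i xs rest σ (i≢j ∘ sym) ⟩
        set i rest (set j xs σ) ∎)
      where
      open ≡-Reasoning
      i≢0 = toWitnessFalse i#0
      j≢0 = toWitnessFalse j#0
      i≢j = toWitnessFalse i#j
      σ₁ = set i rest (set zero (reverse xs) σ)

      I : List (Token n) → List (Token n) → Store (suc k)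
      I xs ys = set i (xs ++ s ∷ rest) (set zero ys σ)

      body : ∀ {d} → Prog d
      body = pop i (onJust (λ x → if stop x then push i x else push zero x))

      scan : ∀ {d} m xs ys → All (λ x → stop x ≡ false) xs → List.length xs ≤ m →
             Iter (Exec N {d} body) m (I xs ys) (I [] (xs ʳ++ ys))
      scan zero    [] ys _ _ = []
      scan (suc m) [] ys _ _ =
        pop-≡ (get-set i (s ∷ rest) _) (castˡ (set-set i rest (s ∷ rest) _) again) ∷
        scan m [] ys [] z≤n
        where
        again : ∀ {d} → Exec N {d} (if stop s then push i s else push zero s)
                          (set i rest (set zero ys σ)) (I [] ys)
        again rewrite halt = push-≡ (trans
          (cong (λ zs → set i (s ∷ zs) (set i rest (set zero ys σ))) (get-set i rest _))
          (set-set i (s ∷ rest) rest _))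
      scan (suc m) (x ∷ xs) ys (e ∷ es) (s≤s l) =
        pop-≡ (get-set i (x ∷ xs ++ s ∷ rest) _)
          (castˡ (set-set i _ (x ∷ xs ++ s ∷ rest) _) (next e)) ∷
        scan m xs (x ∷ ys) es l
        where
        next : ∀ {d} → stop x ≡ false →
               Exec N {d} (if stop x then push i x else push zero x) (I xs ys) (I xs (x ∷ ys))
        next e rewrite e = push-≡ (trans (cong (λ zs → set zero (x ∷ zs) (I xs ys))
          (trans (get-set-≢ zero i _ _ (i≢0 ∘ sym)) (get-set zero ys σ)))
          (set-under zero i (x ∷ ys) (xs ++ s ∷ rest) ys σ (i≢0 ∘ sym)))

    foldl-bits : ∀ {Y : Set} (f : Y → Bool) ys as →
      foldl (λ a y → bit (f y) ∷ a) as ys ≡ bits f ys ʳ++ as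
    foldl-bits f []       as = refl
    foldl-bits f (y ∷ ys) as = foldl-bits f ys (bit (f y) ∷ as)

    combine-exec : ∀ {Y : Set} {d} op i j {σ} {_ : i ≠ zero} {_ : j ≠ zero} {_ : i ≠ j}
      (f g : Y → Bool) ys → get i σ ≡ bits f ys → get j σ ≡ bits g ys →
      get zero σ ≡ [] → List.length ys ≤ N →
      Exec N (combine {d} op i j) σ (set i (bits (λ y → op (f y) (g y)) ys) (set j [] σ))
    combine-exec {Y} op i j {σ@(_ , _)} {i#0} {j#0} {i#j} f g ys i≡ j≡ t≡ l =
      castˡ (trans (sym (set-same i σ i≡)) (cong (set i (bits f ys))
              (trans (sym (set-same j σ j≡))
                     (cong (set j (bits g ys)) (sym (set-same zero σ t≡))))))
        (loop I (λ a y → bit (op (f y) (g y)) ∷ a)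
          (λ y ys a → pop-≡ (get-set i (bits f (y ∷ ys)) _)
            (castˡ (set-set i _ (bits f (y ∷ ys)) _)
              (pop-≡ (trans (get-set-≢ j i _ _ (i≢j ∘ sym)) (get-set j (bits g (y ∷ ys)) _))
                (castˡ (set-under j i (bits g ys) (bits f ys) _ _ (i≢j ∘ sym))
                  (push-≡ (trans (cong (λ zs → set zero (bit (op (f y) (g y)) ∷ zs) (I ys a))
                      (trans (get-set-≢ zero i _ _ (i≢0 ∘ sym))
                        (trans (get-set-≢ zero j _ _ (j≢0 ∘ sym)) (get-set zero a σ))))
                    (trans (set-comm zero i _ (bits f ys) _ (i≢0 ∘ sym))
                      (cong (set i (bits f ys))
                        (set-under zero j _ (bits g ys) a σ (j≢0 ∘ sym))))))))))
          (λ a → pop-≡ (get-set i [] _) (castˡ (set-set i [] [] _) skip))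
          ys [] l) ⨾
      cast (move-exec′ zero i (i≢0 ∘ sym) (subst (λ zs → List.length zs ≤ N) (sym gz)
             (reverse-length≤ {xs = zs} (subst (_≤ N) (sym (length-map _ ys)) l)))) (begin
        set zero [] (set i (get zero σ₁ ʳ++ get i σ₁) σ₁)
          ≡⟨ cong (λ ws → set zero [] (set i ws σ₁))
               (trans (cong₂ _ʳ++_ gz (get-set i [] _)) (reverse-involutive zs)) ⟩
        set zero [] (set i zs (set i [] (set j [] (set zero as σ))))
          ≡⟨ cong (set zero []) (set-set i zs [] _) ⟩
        set zero [] (set i zs (set j [] (set zero as σ)))
          ≡⟨ set-comm zero i [] zs _ (i≢0 ∘ sym) ⟩
        set i zs (set zero [] (set j [] (set zero as σ)))
          ≡⟨ cong (set i zs) (set-under zero j [] [] as σ (j≢0 ∘ sym)) ⟩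
        set i zs (set j [] (set zero [] σ))
          ≡⟨ cong (λ τ → set i zs (set j [] τ)) (set-same zero σ t≡) ⟩
        set i zs (set j [] σ) ∎)
      where
      open ≡-Reasoning
      i≢0 = toWitnessFalse i#0
      j≢0 = toWitnessFalse j#0
      i≢j = toWitnessFalse i#j
      zs = bits (λ y → op (f y) (g y)) ys
      as = foldl (λ a y → bit (op (f y) (g y)) ∷ a) [] ys

      I : List Y → List (Token n) → Store (suc k)
      I ys a = set i (bits f ys) (set j (bits g ys) (set zero a σ))

      σ₁ = I [] as

      gz : get zero σ₁ ≡ reverse zs
      gz = trans (get-set-≢ zero i [] _ (i≢0 ∘ sym)) (trans (get-set-≢ zero j [] _ (j≢0 ∘ sym))
             (trans (get-set zero as σ) (foldl-bits _ ys [])))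

-- Evaluation of formulas

open Equivalence using (to; from)

implies : Bool → Bool → Bool
implies p q = ¬ᵇ p ∨ q

∨-true : ∀ b c → b ∨ c ≡ true ⇔ (b ≡ true ⊎ c ≡ true)
∨-true true  c = mk⇔ inj₁ (λ _ → refl)
∨-true false c = mk⇔ inj₂ [ (λ ()) , id ]′

∧-true : ∀ b c → b ∧ c ≡ true ⇔ (b ≡ true × c ≡ true)
∧-true true  c = mk⇔ (refl ,_) proj₂
∧-true false c = mk⇔ (λ ()) (λ ())

implies-true : ∀ b c → implies b c ≡ true ⇔ (b ≡ true → c ≡ true)
implies-true true  c = mk⇔ (λ e _ → e) (λ f → f refl)
implies-true false c = mk⇔ (λ _ ()) (λ _ → refl)

escape : ∀ v b e → (b ≡ true → e ≡ true) → v ∨ (b ∧ ¬ᵇ e) ≡ true → v ≡ true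
escape true  b     e     h _  = refl
escape false true  false h _  = h refl
escape false true  true  h ()
escape false false e     h ()

infix 4 _⊑_

_⊑_ : ∀ {m} → (Fin m → Bool) → (Fin m → Bool) → Set
f ⊑ g = ∀ i → f i ≡ true → g i ≡ true

count : ∀ {m} → (Fin m → Bool) → ℕ
count {zero}  f = 0
count {suc m} f = (if f zero then 1 else 0) + count (f ∘ suc)

count≤ : ∀ {m} (f : Fin m → Bool) → count f ≤ m
count≤ {zero}  f = z≤n
count≤ {suc m} f with f zero
... | true  = s≤s (count≤ (f ∘ suc))
... | false = m≤n⇒m≤1+n (count≤ (f ∘ suc))

⊑⇒count≤ : ∀ {m} (f g : Fin m → Bool) → g ⊑ f → count g ≤ count f
⊑⇒count≤ {zero}  f g g⊑f = z≤n
⊑⇒count≤ {suc m} f g g⊑f with ⊑⇒count≤ (f ∘ suc) (g ∘ suc) (g⊑f ∘ suc) | g zero | f zero | g⊑f zero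
... | le | true  | true  | _ = s≤s le
... | le | true  | false | h with () ← h refl
... | le | false | true  | _ = m≤n⇒m≤1+n le
... | le | false | false | _ = le

-- A subset of a finite set is the whole set or has fewer elements. Equality is phrased as the
-- reverse inclusion, which needs no function extensionality.
⊑⊎count< : ∀ {m} (f g : Fin m → Bool) → g ⊑ f → f ⊑ g ⊎ count g < count f
⊑⊎count< {zero}  f g g⊑f = inj₁ λ ()
⊑⊎count< {suc m} f g g⊑f
  with ⊑⊎count< (f ∘ suc) (g ∘ suc) (g⊑f ∘ suc) | ⊑⇒count≤ (f ∘ suc) (g ∘ suc) (g⊑f ∘ suc)
     | g zero in eg | f zero in ef | g⊑f zero
... | _       | le | false | true  | _ = inj₂ (s≤s le)
... | _       | _  | true  | false | h with () ← h refl
... | inj₂ lt | _  | true  | true  | _ = inj₂ (s≤s lt)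
... | inj₂ lt | _  | false | false | _ = inj₂ lt
... | inj₁ le | _  | true  | true  | _ = inj₁ λ { zero _ → eg ; (suc i) → le i }
... | inj₁ le | _  | false | false | _ =
  inj₁ λ { zero e → trans (trans eg (sym ef)) e ; (suc i) → le i }

module Descent {m : ℕ} (F : (Fin m → Bool) → Fin m → Bool)
  (mono : ∀ {f g : Fin m → Bool} → f ⊑ g → F f ⊑ F g) where

  iter : ℕ → (Fin m → Bool) → Fin m → Bool
  iter zero    f = f
  iter (suc j) f = iter j (F f)

  iter-below : ∀ j {f} → F f ⊑ f → iter j f ⊑ f
  iter-below zero    d i e = e
  iter-below (suc j) d i e = d i (iter-below j (mono d) i e)

  iter-above : ∀ j {f} → f ⊑ F f → f ⊑ iter j f
  iter-above zero    a i e = e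
  iter-above (suc j) a i e = iter-above j (mono a) i (a i e)

  -- A decreasing sequence of sets loses an element at every step until it is
  -- constant.
  stabilises : ∀ c {f} → count f ≤ c → F f ⊑ f → ∀ j → iter c f ⊑ iter j f
  stabilises c       {f} f≤c d zero    i e = iter-below c d i e
  stabilises c       {f} f≤c d (suc j) i e with ⊑⊎count< f (F f) d
  -- A step that loses nothing has reached a fixed point: f lies below all its iterates, while
  -- `iter c f` lies below f.
  stabilises c       {f} f≤c d (suc j) i e | inj₁ f⊑Ff =
    iter-above (suc j) f⊑Ff i (iter-below c d i e)
  stabilises zero    {f} f≤c d (suc j) i e | inj₂ lt with () ← ≤-trans lt f≤c
  stabilises (suc c) {f} f≤c d (suc j) i e | inj₂ lt =
    stabilises c (≤-pred (≤-trans lt f≤c)) (mono d) j i e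

module Evaluation {n : ℕ} (𝓕 : FiniteModel n) (N : ℕ) where

  open FiniteModel 𝓕

  states : List (Fin ∣W∣)
  states = allFin ∣W∣

  abilities : List (Fin ∣A∣)
  abilities = allFin ∣A∣

  capb : Fin n → Fin ∣A∣ → Bool
  capb a = Vec.lookup (cap a)

  edgeb : Fin ∣W∣ → Fin ∣W∣ → Fin ∣A∣ → Bool
  edgeb s t = Vec.lookup (edge s t)

  -- With v the truth value of P at t and ε the edge from s to t, the result is true iff `β ⊆ ε`
  -- implies P at t: the accumulator becomes true for good at the first element of β outside ε.
  violated : ∀ {Y : Set} → (Y → Bool) → (Y → Bool) → List Y → Bool → Bool
  violated β ε ys v = foldl (λ v y → v ∨ (β y ∧ ¬ᵇ (ε y))) v ys

  necessary : (Fin ∣A∣ → Bool) → (Fin ∣W∣ → Bool) → Fin ∣W∣ → Bool → List (Fin ∣W∣) → Bool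
  necessary β π s = foldl (λ k t → k ∧ violated β (edgeb s t) abilities (π t))

  gathered : (Bool → Bool → Bool) → (Fin ∣A∣ → Bool) → List (Fin n) → Fin ∣A∣ → Bool
  gathered op = foldl (λ β a y → op (β y) (capb a y))

  necessity-value : Bool → (Bool → Bool → Bool) → List (Fin n) → (Fin ∣W∣ → Bool) → Fin ∣W∣ → Bool
  necessity-value unit op as π s = necessary (gathered op (λ _ → unit) as) π s true states

  everyone-value : List (Fin n) → (Fin ∣W∣ → Bool) → (Fin ∣W∣ → Bool) → Fin ∣W∣ → Bool
  everyone-value as π ρ =
    -- The disjunct `false` computes away; it is present because the program merges the capability
    -- row into a vector filled with `false`.
    foldl (λ ρ a s → necessary (λ y → false ∨ capb a y) π s (ρ s) states) ρ as

  round-value : List (Fin n) → (Fin ∣W∣ → Bool) → (Fin ∣W∣ → Bool) → Fin ∣W∣ → Bool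
  round-value as π ρ = everyone-value as (λ s → π s ∧ ρ s) (λ _ → true)

  rounds : List (Fin n) → (Fin ∣W∣ → Bool) → ℕ → (Fin ∣W∣ → Bool) → Fin ∣W∣ → Bool
  rounds as π zero    ρ = ρ
  rounds as π (suc m) ρ = rounds as π m (round-value as π ρ)

  -- N is the loop length at hand and takes the place of the number of states; when it is at least
  -- that number, the extra rounds act on a set that no longer changes.
  common-value : List (Fin n) → (Fin ∣W∣ → Bool) → Fin ∣W∣ → Bool
  common-value as π = rounds as π N (λ _ → true)

  groupList : Group n → List (Fin n)
  groupList G = List.filter (Subset._∈? members G) (allFin n)

  modal-value : Letter → List (Fin n) → (Fin ∣W∣ → Bool) → Fin ∣W∣ → Bool
  modal-value C = common-value
  modal-value D = necessity-value false _∨_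
  modal-value M = necessity-value true _∧_

  eval : ∀ {X} → Formula n X → Fin ∣W∣ → Bool
  eval (atom p)      s = val s p
  -- Negation as implication of falsity: one pointwise operation then serves both connectives.
  eval (neg φ)       s = implies (eval φ s) false
  eval (φ ⇒ ψ)       s = implies (eval φ s) (eval ψ s)
  -- Individual knowledge is treated as distributed knowledge of a one-agent group.
  eval (K a φ)         = necessity-value false _∨_ (a ∷ []) (eval φ)
  eval (box l _ G φ)   = modal-value l (groupList G) (eval φ)

  -- Agreement of the Boolean evaluation with satisfaction

  violated-true : ∀ {Y : Set} (β ε : Y → Bool) ys v →
    violated β ε ys v ≡ true ⇔ (All (λ y → β y ≡ true → ε y ≡ true) ys → v ≡ true)
  violated-true β ε []       v = mk⇔ (λ e _ → e) (λ f → f [])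
  violated-true β ε (y ∷ ys) v = mk⇔
    (λ { e (h ∷ hs) → escape v (β y) (ε y) h (to (violated-true β ε ys _) e hs) })
    (λ f → from (violated-true β ε ys _) (fails f))
    where
    fails : (All (λ y → β y ≡ true → ε y ≡ true) (y ∷ ys) → v ≡ true) →
            All (λ y → β y ≡ true → ε y ≡ true) ys → v ∨ (β y ∧ ¬ᵇ (ε y)) ≡ true
    fails f hs with β y in eb | ε y in ee
    ... | true  | false = from (∨-true v true) (inj₂ refl)
    ... | true  | true  = from (∨-true v false) (inj₁ (f ((λ _ → ee) ∷ hs)))
    ... | false | _     =
      from (∨-true v false) (inj₁ (f ((λ e → case trans (sym eb) e of λ ()) ∷ hs)))

  foldl-∧-true : ∀ {Y : Set} (g : Y → Bool) ys w →
    foldl (λ w y → w ∧ g y) w ys ≡ true ⇔ (w ≡ true × All (λ y → g y ≡ true) ys)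
  foldl-∧-true g []       w = mk⇔ (_, []) proj₁
  foldl-∧-true g (y ∷ ys) w = mk⇔
    (λ e → let wg , all = to (foldl-∧-true g ys _) e
               w≡ , g≡ = to (∧-true w (g y)) wg
           in w≡ , g≡ ∷ all)
    (λ { (w≡ , g≡ ∷ all) → from (foldl-∧-true g ys _) (from (∧-true w (g y)) (w≡ , g≡) , all) })

  private
    𝓜 = toModel 𝓕

  Decides : ∀ {m} → (Fin m → Bool) → Pred (Fin m) 0ℓ → Set
  Decides π P = ∀ s → π s ≡ true ⇔ P s

  cap-true : ∀ a x → capb a x ≡ true ⇔ (x Subset.∈ cap a)
  cap-true a x = mk⇔ (lookup⇒[]= x (cap a)) []=⇒lookup

  edge-true : ∀ s t x → edgeb s t x ≡ true ⇔ (x Subset.∈ edge s t)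
  edge-true s t x = mk⇔ (lookup⇒[]= x (edge s t)) []=⇒lookup

  necessary-true : ∀ {β B π P} → Decides β B → Decides π P → ∀ s w →
    necessary β π s w states ≡ true ⇔ (w ≡ true × Necessary 𝓜 B P s)
  necessary-true {β} {B} {π} {P} β-B π-P s w = mk⇔
    (λ e → let w≡ , all = to (foldl-∧-true _ states w) e in w≡ , λ t B⊆ →
      to (π-P t) (to (violated-true β (edgeb s t) abilities (π t)) (All.tabulate⁻ all t)
        (All.tabulate⁺ λ y e′ → from (edge-true s t y) (B⊆ (to (β-B y) e′)))))
    (λ (w≡ , nec) → from (foldl-∧-true _ states w) (w≡ , All.tabulate⁺ λ t →
      from (violated-true β (edgeb s t) abilities (π t)) λ all →
        from (π-P t) (nec t λ {y} By →
          to (edge-true s t y) (All.tabulate⁻ all y (from (β-B y) By)))))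

  gathered-∨ : ∀ as β y → gathered _∨_ β as y ≡ true ⇔
    (β y ≡ true ⊎ ∃[ a ] a ∈ as × y Subset.∈ cap a)
  gathered-∨ []       β y = mk⇔ inj₁ [ id , (λ { (_ , () , _) }) ]′
  gathered-∨ (a ∷ as) β y = mk⇔
    (λ e → [ (λ e′ → [ inj₁ , (λ c → inj₂ (a , here refl , to (cap-true a y) c)) ]′
                       (to (∨-true (β y) (capb a y)) e′))
           , (λ (b , b∈ , y∈) → inj₂ (b , there b∈ , y∈)) ]′ (to (gathered-∨ as _ y) e))
    (λ { (inj₁ e) → from (gathered-∨ as _ y) (inj₁ (from (∨-true (β y) (capb a y)) (inj₁ e)))
       ; (inj₂ (_ , here refl , y∈)) →
           from (gathered-∨ as _ y)
             (inj₁ (from (∨-true (β y) (capb a y)) (inj₂ (from (cap-true a y) y∈))))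
       ; (inj₂ (b , there b∈ , y∈)) → from (gathered-∨ as _ y) (inj₂ (b , b∈ , y∈)) })

  gathered-∧ : ∀ as β y → gathered _∧_ β as y ≡ true ⇔
    (β y ≡ true × (∀ a → a ∈ as → y Subset.∈ cap a))
  gathered-∧ []       β y = mk⇔ (λ e → e , λ _ ()) proj₁
  gathered-∧ (a ∷ as) β y = mk⇔
    (λ e → let e′ , h = to (gathered-∧ as _ y) e
               β≡ , c≡ = to (∧-true (β y) (capb a y)) e′
           in β≡ , λ { _ (here refl) → to (cap-true a y) c≡ ; b (there b∈) → h b b∈ })
    (λ (β≡ , h) → from (gathered-∧ as _ y)
      (from (∧-true (β y) (capb a y)) (β≡ , from (cap-true a y) (h a (here refl))) ,
       λ b b∈ → h b (there b∈)))

  everyone-true : ∀ {π P} → Decides π P → ∀ as ρ s → everyone-value as π ρ s ≡ true ⇔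
    (ρ s ≡ true × (∀ a → a ∈ as → Necessary 𝓜 (Subset._∈ cap a) P s))
  everyone-true π-P []       ρ s = mk⇔ (λ e → e , λ _ ()) proj₁
  everyone-true π-P (a ∷ as) ρ s = mk⇔
    (λ e → let e′ , h = to (everyone-true π-P as _ s) e
               ρ≡ , nec = to (necessary-true (cap-true a) π-P s (ρ s)) e′
           in ρ≡ , λ { _ (here refl) → nec ; b (there b∈) → h b b∈ })
    (λ (ρ≡ , h) → from (everyone-true π-P as _ s)
      (from (necessary-true (cap-true a) π-P s (ρ s)) (ρ≡ , h a (here refl)) ,
       λ b b∈ → h b (there b∈)))

  groupList-∈ : ∀ G a → a ∈ groupList G ⇔ (a Subset.∈ members G)
  groupList-∈ G a = mk⇔ (λ a∈ → proj₂ (∈-filter⁻ (Subset._∈? members G) {xs = allFin n} a∈))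
    (∈-filter⁺ (Subset._∈? members G) (∈-allFin a))

  round-true : ∀ {π P ρ R} → Decides π P → Decides ρ R → ∀ G s →
    round-value (groupList G) π ρ s ≡ true ⇔ Everyone 𝓜 G (λ t → P t × R t) s
  round-true {π} {P} {ρ} {R} π-P ρ-R G s = mk⇔
    (λ e a a∈ →
      proj₂ (to (everyone-true π∧ρ (groupList G) _ s) e) a (from (groupList-∈ G a) a∈))
    (λ h → from (everyone-true π∧ρ (groupList G) _ s)
      (refl , λ a a∈ → h a (to (groupList-∈ G a) a∈)))
    where
    π∧ρ : Decides (λ t → π t ∧ ρ t) (λ t → P t × R t)
    π∧ρ t = mk⇔ (λ e → let p , r = to (∧-true (π t) (ρ t)) e in to (π-P t) p , to (ρ-R t) r)
                (λ (p , r) → from (∧-true (π t) (ρ t)) (from (π-P t) p , from (ρ-R t) r))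

  module _ (G : Group n) {π : Fin ∣W∣ → Bool} {P : Pred (Fin ∣W∣) 0ℓ} (π-P : Decides π P) where

    private
      F = round-value (groupList G) π

    round-mono : ∀ {ρ ρ′} → ρ ⊑ ρ′ → F ρ ⊑ F ρ′
    -- A Boolean vector decides the set where it is `true`, so `round-true` applies to arbitrary
    -- vectors, and monotonicity follows from that of `Everyone`.
    round-mono ρ⊑ρ′ s e = from (round-true π-P (λ _ → mk⇔ id id) G s) λ a a∈ t c →
      let p , r = to (round-true π-P (λ _ → mk⇔ id id) G s) e a a∈ t c in p , ρ⊑ρ′ t r

    open Descent F round-mono

    rounds≡iter : ∀ m ρ → rounds (groupList G) π m ρ ≡ iter m ρ
    rounds≡iter zero    ρ = refl
    rounds≡iter (suc m) ρ = rounds≡iter m (F ρ)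

    iter-suc : ∀ m ρ → iter (suc m) ρ ≡ F (iter m ρ)
    iter-suc zero    ρ = refl
    iter-suc (suc m) ρ = iter-suc m (F ρ)

    -- E commutes with conjunction: applying it to P together with the first m powers yields the
    -- first m + 1 powers. The start, true everywhere, is the empty conjunction.
    iter-true : ∀ m → Decides (iter m (λ _ → true)) (λ s → ∀ j → j < m → Everyone^ 𝓜 (suc j) G P s)
    iter-true zero    s = mk⇔ (λ _ _ ()) (λ _ → refl)
    iter-true (suc m) s = mk⇔
      (λ e → λ { zero    _         a a∈ t c → proj₁ (unfolded e a a∈ t c)
               ; (suc j) (s≤s j<m) a a∈ t c → proj₂ (unfolded e a a∈ t c) j j<m })
      (λ h → subst (λ f → f s ≡ true) (sym (iter-suc m (λ _ → true)))
        (from (round-true π-P (iter-true m) G s) λ a a∈ t c →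
          h zero (s≤s z≤n) a a∈ t c , λ j j<m → h (suc j) (s≤s j<m) a a∈ t c))
      where
      unfolded : iter (suc m) (λ _ → true) s ≡ true → _
      unfolded e = to (round-true π-P (iter-true m) G s)
        (subst (λ f → f s ≡ true) (iter-suc m (λ _ → true)) e)

    -- The N-th iterate speaks of N powers only, but by `stabilises` it is contained in every
    -- iterate, and the iterate `suc m` includes the power `suc m`. The descent starts from the full
    -- set, whose size is where `∣W∣ ≤ N` enters.
    common-true : ∣W∣ ≤ N → Decides (common-value (groupList G) π) (Modal 𝓜 C G P)
    common-true W≤N s = mk⇔
      (λ { e (suc m) _ → to (iter-true (suc m) s)
             (stabilises N (≤-trans (count≤ {∣W∣} (λ _ → true)) W≤N) (λ _ _ → refl) (suc m) s
               (subst (λ f → f s ≡ true) (rounds≡iter N _) e)) m ≤-refl })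
      (λ h → subst (λ f → f s ≡ true) (sym (rounds≡iter N _))
        (from (iter-true N s) λ j _ → h (suc j) (s≤s z≤n)))

  modal-true : ∣W∣ ≤ N → ∀ l G {π P} → Decides π P →
    Decides (modal-value l (groupList G) π) (Modal 𝓜 l G P)
  modal-true W≤N C G π-P   = common-true G π-P W≤N
  modal-true W≤N D G π-P s = mk⇔
    (λ e → proj₂ (to (necessary-true union π-P s true) e))
    (λ h → from (necessary-true union π-P s true) (refl , h))
    where
    union : Decides (gathered _∨_ (λ _ → false) (groupList G))
                    (⋃ (Member G) (λ a x → x Subset.∈ cap (proj₁ a)))
    union x = mk⇔
      (λ e → [ (λ ()) , (λ (a , a∈ , x∈) → (a , to (groupList-∈ G a) a∈) , x∈) ]′
               (to (gathered-∨ (groupList G) _ x) e))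
      (λ ((a , a∈) , x∈) →
        from (gathered-∨ (groupList G) _ x) (inj₂ (a , from (groupList-∈ G a) a∈ , x∈)))
  modal-true W≤N M G π-P s = mk⇔
    (λ e → proj₂ (to (necessary-true intersection π-P s true) e))
    (λ h → from (necessary-true intersection π-P s true) (refl , h))
    where
    intersection : Decides (gathered _∧_ (λ _ → true) (groupList G))
                           (⋂ (Member G) (λ a x → x Subset.∈ cap (proj₁ a)))
    intersection x = mk⇔
      (λ e (a , a∈) → proj₂ (to (gathered-∧ (groupList G) _ x) e) a (from (groupList-∈ G a) a∈))
      (λ h → from (gathered-∧ (groupList G) _ x) (refl , λ a a∈ → h (a , to (groupList-∈ G a) a∈)))

  eval-true : ∣W∣ ≤ N → ∀ {X} (φ : Formula n X) → Decides (eval φ) (λ s → 𝓜 , s ⊨ φ)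
  eval-true W≤N (atom p) s = mk⇔ id id
  eval-true W≤N (neg φ) s = mk⇔
    (λ e h → false≢true (to (implies-true (eval φ s) false) e (from (eval-true W≤N φ s) h)))
    (λ h → from (implies-true (eval φ s) false) λ e → ⊥-elim (h (to (eval-true W≤N φ s) e)))
    where
    false≢true : false ≡ true → ⊥
    false≢true ()
  eval-true W≤N (φ ⇒ ψ) s = mk⇔
    (λ e h → to (eval-true W≤N ψ s)
      (to (implies-true (eval φ s) (eval ψ s)) e (from (eval-true W≤N φ s) h)))
    (λ h → from (implies-true (eval φ s) (eval ψ s)) λ e →
      from (eval-true W≤N ψ s) (h (to (eval-true W≤N φ s) e)))
  eval-true W≤N (K a φ) s = mk⇔
    (λ e → proj₂ (to (necessary-true (cap-true a) (eval-true W≤N φ) s true) e))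
    (λ h → from (necessary-true (cap-true a) (eval-true W≤N φ) s true) (refl , h))
  eval-true W≤N (box l _ G φ) = modal-true W≤N l G (eval-true W≤N φ)

  eval-reflects : ∣W∣ ≤ N → ∀ {X} (φ : Formula n X) s → Reflects (𝓜 , s ⊨ φ) (eval φ s)
  eval-reflects W≤N φ s with eval φ s | eval-true W≤N φ s
  ... | true  | h = ofʸ (to h refl)
  ... | false | h = ofⁿ λ p → case-false (from h p)
    where
    case-false : false ≡ true → ⊥
    case-false ()

-- The model checking program

-- Besides the scratch register 0: the formula still to be read and the stack of
-- truth vectors (F, V), a group and a copy of it (G, H), a set of abilities and a
-- copy of it or a row of the table of capabilities (B, C), the truth vector of the
-- immediate subformula and a copy of it (P, Q), the result and its reverse (R, O),
-- what remains of the table of edges or capabilities (E), two truth values (S, K),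
-- what remains of the valuation (X), and the argument of common knowledge (Z).
-- The other registers are filled by the parser and then only read.
pattern rF = 1F
pattern rV = 2F
pattern rG = 3F
pattern rH = 4F
pattern rB = 5F
pattern rC = 6F
pattern rP = 7F
pattern rQ = 8F
pattern rR = 9F
pattern rO = suc 9F
pattern rE = suc rO
pattern rS = suc rE
pattern rK = suc rS
pattern rX = suc rK
pattern rZ = suc rX
pattern rStates = suc rZ
pattern rAbilities = suc rStates
pattern rCaps = suc rAbilities
pattern rEdges = suc rCaps
pattern rVals = suc rEdges
pattern rState = suc rVals

length-++≤ˡ : ∀ {A : Set} (xs : List A) {ys m} → List.length (xs ++ ys) ≤ m → List.length xs ≤ m
length-++≤ˡ xs = ≤-trans (≤-trans (m≤m+n _ _) (≤-reflexive (sym (length-++ xs))))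

length-++≤ʳ : ∀ {A : Set} (xs : List A) {y ys m} →
  List.length (xs ++ y ∷ ys) ≤ m → List.length ys ≤ m
length-++≤ʳ xs = ≤-trans (≤-trans (≤-trans (n≤1+n _) (m≤n+m _ (List.length xs)))
                                  (≤-reflexive (sym (length-++ xs))))

module Checker (n : ℕ) where

  open Operations n 21
  open Stacks (Token n) 22

  comma? end? : Token n → Bool
  comma? comma = true
  comma? _     = false
  end? end = true
  end? _   = false

  forAgent : ∀ {d} → (Fin n → Prog d) → Token n → Prog d
  forAgent f (agent a) = f a
  forAgent f _         = skip

  copy : ∀ {d} → Fin 22 → Fin 22 → Prog (suc d)
  copy = copyWith id

  -- The unary numbers of states and abilities in the input serve as templates for constant vectors:
  -- every tally becomes the bit b.
  fill : ∀ {d} → Bool → Fin 22 → Fin 22 → Prog (suc d)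
  fill b = copyWith (λ _ → bit b)

  violation : ∀ {d} → Prog (suc d)
  -- C is popped first, so once it is exhausted E is left alone and the comma after the current row
  -- survives.
  violation = repeat (popBit rC λ b → popBit rE λ e → popBit rS λ v →
    push rS (bit (v ∨ (b ∧ ¬ᵇ e))))

  successors : ∀ {d} → Prog (2 + d)
  successors = repeat (popBit rQ λ p →
    -- S starts with the truth value of P at the successor; the pop of E discards the comma that
    -- ends the edge row.
    push rS (bit p) ⨾ copy rB rC ⨾ violation ⨾ pop rE (λ _ → skip) ⨾
    popBit rS (λ v → popBit rK λ k → push rK (bit (k ∧ v))))

  -- Restricts the set R to the states where P is necessary for the
  -- capability B.
  restrict : ∀ {d} → Prog (3 + d)
  restrict =
    copy rEdges rE ⨾
    repeat (popBit rR λ r →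
      push rK (bit r) ⨾ copy rP rQ ⨾ successors ⨾ popBit rK (λ k → push rO (bit k))) ⨾
    move→ rO rR ⨾ clear rB

  -- There is a fixed number of agents, so the row of an agent is selected by the text of the
  -- program and not by a loop.
  pickRow : ∀ {d} → ℕ → Prog (suc d)
  pickRow zero    = takeUntil comma? rE rC
  pickRow (suc m) = takeUntil comma? rE rO ⨾ clear rO ⨾ pickRow m

  fetch : ∀ {d} → Fin n → Prog (suc d)
  fetch a = copy rCaps rE ⨾ pickRow (toℕ a) ⨾ clear rE

  gather : ∀ {d} → (Bool → Bool → Bool) → Prog (2 + d)
  gather op = repeat (pop rG (onJust (forAgent λ a → fetch a ⨾ combine op rB rC)))

  necessity : ∀ {d} → Bool → (Bool → Bool → Bool) → Prog (3 + d)
  necessity unit op =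
    takeUntil comma? rV rP ⨾ fill true rStates rR ⨾ fill unit rAbilities rB ⨾
    gather op ⨾ restrict ⨾ clear rP ⨾ store rR rV

  everyone : ∀ {d} → Prog (4 + d)
  everyone = repeat (pop rH (onJust (forAgent λ a →
    fill false rAbilities rB ⨾ fetch a ⨾ combine _∨_ rB rC ⨾ restrict)))

  -- R := E (Z ∧ R), for the group in G.
  round : ∀ {d} → Prog (4 + d)
  round =
    copy rZ rP ⨾ combine _∧_ rP rR ⨾ fill true rStates rR ⨾ copy rG rH ⨾ everyone ⨾ clear rP

  common : ∀ {d} → Prog (5 + d)
  common =
    takeUntil comma? rV rZ ⨾ fill true rStates rR ⨾ repeat round ⨾ clear rZ ⨾ clear rG ⨾ store rR rV

  -- An atom is read one symbol at a time: every tally skips a row of the valuation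
  -- in X, and X is restored when the row at the comma has been stored.
  handle : ∀ {d} → Token n → Prog (5 + d)
  handle tally     = takeUntil comma? rX rP ⨾ clear rP
  handle comma     = takeUntil comma? rX rP ⨾ store rP rV ⨾ clear rX ⨾ copy rVals rX
  handle not       =
    takeUntil comma? rV rP ⨾ fill false rStates rR ⨾ combine implies rP rR ⨾ store rP rV
  handle imp       =
    takeUntil comma? rV rR ⨾ takeUntil comma? rV rP ⨾ combine implies rP rR ⨾ store rP rV
  handle know      = pop rF (onJust (push rG)) ⨾ necessity false _∨_
  handle (modal C) = takeUntil comma? rF rG ⨾ common
  handle (modal D) = takeUntil comma? rF rG ⨾ necessity false _∨_
  handle (modal M) = takeUntil comma? rF rG ⨾ necessity true _∧_
  handle _         = skip

  parse : ∀ {d} → Prog (suc d)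
  parse =
    -- The input arrives reversed in register 0; this move puts its first symbol on top.
    move→ 0F rF ⨾ takeUntil comma? rF rStates ⨾ takeUntil comma? rF rAbilities ⨾
    takeUntil end? rF rCaps ⨾ takeUntil end? rF rEdges ⨾ takeUntil end? rF rVals ⨾
    takeUntil comma? rF rState ⨾ copy rVals rX

  -- The six nested loops, met in the case of common knowledge, run over tokens, rounds, agents,
  -- states, successors and abilities.
  evaluate : Prog 6
  evaluate = repeat (pop rF (onJust handle))

  -- The designated state is given in unary, so each of its tallies drops one bit of the truth
  -- vector, and the answer is then on top of V.
  checker : Prog 6
  checker = parse ⨾ evaluate ⨾ repeat (pop rState (onJust λ _ → pop rV λ _ → skip))

  -- The continuation `rest` is built in rather than appended, so that the table left after reading
  -- a row has the same shape by computation, without associativity of `_++_`.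
  rows : ∀ {Y Z : Set} → (Y → Z → Bool) → List Z → List Y → List (Token n) → List (Token n)
  rows f zs []       rest = rest
  rows f zs (y ∷ ys) rest = bits (f y) zs ++ comma ∷ rows f zs ys rest

  all-map : ∀ {Y : Set} {P : Token n → Set} (f : Y → Token n) →
    (∀ y → P (f y)) → ∀ ys → All P (map f ys)
  all-map f h ys = All.map⁺ (All.universal h ys)

  -- The program computes the truth vectors

  module Correctness (𝓕 : FiniteModel n) (ps : List Atom) (chosen : List (Token n)) (N : ℕ) where

    open FiniteModel 𝓕
    open Evaluation 𝓕 N
    open Semantics N

    edgeRows : List (Fin ∣W∣) → List (Token n)
    edgeRows []       = []
    edgeRows (s ∷ ss) = rows (edgeb s) abilities states (edgeRows ss)

    statesL abilitiesL capsL edgesL valsL : List (Token n)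
    statesL    = map (λ _ → tally) states
    abilitiesL = map (λ _ → tally) abilities
    capsL      = rows capb abilities (allFin n) []
    edgesL     = edgeRows states
    valsL      = rows (λ p s → val s p) states ps []

    word : List (Token n) → List (Token n)
    word rest = statesL ++ comma ∷ abilitiesL ++ comma ∷ capsL ++ end ∷ edgesL ++ end ∷
      valsL ++ end ∷ chosen ++ comma ∷ rest

    module _ (states≤ : List.length states ≤ N) (abilities≤ : List.length abilities ≤ N)
             (caps≤ : List.length capsL ≤ N) (edges≤ : List.length edgesL ≤ N)
             (vals≤ : List.length valsL ≤ N) (n≤ : n ≤ N) where

      -- The stores between operations: the scratch register is empty and the parsed tables are
      -- fixed. On such explicit tuples `get` and `set` compute, and most side conditions become
      -- `refl`.
      st : (f v g h b c p q r o e s k x z : List (Token n)) → Store 22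
      st f v g h b c p q r o e s k x z =
        [] , f , v , g , h , b , c , p , q , r , o , e , s , k , x , z ,
        statesL , abilitiesL , capsL , edgesL , valsL , chosen , tt

      bits≤ : ∀ {Y : Set} (f : Y → Bool) ys {m} → List.length ys ≤ m → List.length (bits f ys) ≤ m
      bits≤ f ys = subst (_≤ _) (sym (length-map (bit ∘ f) ys))

      map-const : ∀ {Y : Set} b (ys : List Y) →
        map (λ _ → bit b) (map {B = Token n} (λ _ → tally) ys) ≡ bits (λ _ → b) ys
      map-const b ys = sym (map-∘ ys)

      violation-exec : ∀ {d f v g h b p q r o k x z rest} (β ε : Fin ∣A∣ → Bool) ys w →
        List.length ys ≤ N →
        Exec N (violation {d})
          (st f v g h b (bits β ys) p q r o (bits ε ys ++ rest) (bit w ∷ []) k x z)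
          (st f v g h b [] p q r o rest (bit (violated β ε ys w) ∷ []) k x z)
      violation-exec {d} {f} {v} {g} {h} {b} {p} {q} {r} {o} {k} {x} {z} {rest} β ε ys w l =
        loop (λ ys w → st f v g h b (bits β ys) p q r o (bits ε ys ++ rest) (bit w ∷ []) k x z)
          (λ w y → w ∨ (β y ∧ ¬ᵇ (ε y)))
          (λ y ys w → pop (pop (pop push)))
          (λ w → pop skip)
          ys w l

      successors-exec : ∀ {d f v g h p r o x z rest} β π s ts w →
        List.length ts ≤ N →
        Exec N (successors {d})
          (st f v g h (bits β abilities) [] p (bits π ts) r o
              (rows (edgeb s) abilities ts rest) [] (bit w ∷ []) x z)
          (st f v g h (bits β abilities) [] p [] r o rest [] (bit (necessary β π s w ts) ∷ []) x z)
      successors-exec {d} {f} {v} {g} {h} {p} {r} {o} {x} {z} {rest} β π s ts w l =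
        loop (λ ts w → st f v g h (bits β abilities) [] p (bits π ts) r o
                         (rows (edgeb s) abilities ts rest) [] (bit w ∷ []) x z)
          (λ k t → k ∧ violated β (edgeb s t) abilities (π t))
          (λ t ts w → pop
            ( push
            ⨾ copy-exec rB rC refl refl (bits≤ β abilities abilities≤)
            ⨾ violation-exec β (edgeb s t) abilities (π t) abilities≤
            ⨾ pop skip
            ⨾ pop (pop push)))
          (λ w → pop skip)
          ts w l

      restrict-exec : ∀ {d f v g h x z} β π ρ →
        Exec N (restrict {d})
          (st f v g h (bits β abilities) [] (bits π states) [] (bits ρ states) [] [] [] [] x z)
          (st f v g h [] [] (bits π states) []
              (bits (λ s → necessary β π s (ρ s) states) states) [] [] [] [] x z)
      restrict-exec {d} {f} {v} {g} {h} {x} {z} β π ρ =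
        copy-exec rEdges rE refl refl edges≤ ⨾
        loop (λ ss os → st f v g h (bits β abilities) [] (bits π states) []
                          (bits ρ ss) os (edgeRows ss) [] [] x z)
          (λ os s → bit (necessary β π s (ρ s) states) ∷ os)
          (λ s ss os → pop
            ( push
            ⨾ copy-exec rP rQ refl refl (bits≤ π states states≤)
            ⨾ successors-exec β π s states (ρ s) states≤
            ⨾ pop push))
          (λ os → pop skip)
          states [] states≤ ⨾
        castˡ (cong (λ os → st f v g h (bits β abilities) [] (bits π states) [] [] os [] [] [] x z)
                (foldl-bits ρ′ states []))
          (cast (move-exec rO rR (reverse-length≤ {xs = bits ρ′ states} (bits≤ ρ′ states states≤)))
            (cong (λ r → st f v g h (bits β abilities) [] (bits π states) [] r [] [] [] [] x z)
              (reverse-involutive (bits ρ′ states)))) ⨾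
        clear-exec rB _ (bits≤ β abilities abilities≤)
        where
        ρ′ = λ s → necessary β π s (ρ s) states

      -- Stated for any family of agents because the induction passes to the tail of the table. The
      -- bound on the remaining rows is kept for the `clear` that follows.
      pickRow-exec : ∀ {d f v g h b p q r s k x z} m (as : Fin m → Fin n) i →
        List.length (rows capb abilities (tabulate as) []) ≤ N →
        ∃[ rest ] List.length rest ≤ N × Exec N (pickRow {d} (toℕ i))
          (st f v g h b [] p q r [] (rows capb abilities (tabulate as) []) s k x z)
          (st f v g h b (bits (capb (as i)) abilities) p q r [] rest s k x z)
      pickRow-exec (suc m) as zero l =
        _ , length-++≤ʳ (bits (capb (as zero)) abilities) l ,
        takeUntil-exec comma? rE rC (all-map _ (λ _ → refl) abilities) refl refl refl refl
          (bits≤ (capb (as zero)) abilities abilities≤)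
      pickRow-exec (suc m) as (suc i) l =
        let rest , rest≤ , e = pickRow-exec m (as ∘ suc) i
              (length-++≤ʳ (bits (capb (as zero)) abilities) l)
        in rest , rest≤ ,
           takeUntil-exec comma? rE rO (all-map _ (λ _ → refl) abilities) refl refl refl refl
             (bits≤ (capb (as zero)) abilities abilities≤) ⨾
           clear-exec rO _ (bits≤ (capb (as zero)) abilities abilities≤) ⨾ e

      fetch-exec : ∀ {d f v g h b p q r s k x z} a → Exec N (fetch {d} a)
        (st f v g h b [] p q r [] [] s k x z)
        (st f v g h b (bits (capb a) abilities) p q r [] [] s k x z)
      fetch-exec a =
        let rest , rest≤ , e = pickRow-exec n id a caps≤
        in copy-exec rCaps rE refl refl caps≤ ⨾ e ⨾ clear-exec rE _ rest≤

      gather-exec : ∀ {d f v h p q r s k x z} op β as → List.length as ≤ N → Exec N (gather {d} op)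
        (st f v (map agent as) h (bits β abilities) [] p q r [] [] s k x z)
        (st f v [] h (bits (gathered op β as) abilities) [] p q r [] [] s k x z)
      gather-exec {d} {f} {v} {h} {p} {q} {r} {s} {k} {x} {z} op β as l =
        loop (λ as β → st f v (map agent as) h (bits β abilities) [] p q r [] [] s k x z)
          (λ β a y → op (β y) (capb a y))
          (λ a as β → pop
            ( fetch-exec a
            ⨾ combine-exec op rB rC β (capb a) abilities refl refl refl abilities≤))
          (λ β → pop skip)
          as β l

      fill-states : ∀ {d f v g h b c p q o e s k x z} w → Exec N (fill {d} w rStates rR)
        (st f v g h b c p q [] o e s k x z)
        (st f v g h b c p q (bits (λ _ → w) states) o e s k x z)
      fill-states {f = f} {v} {g} {h} {b} {c} {p} {q} {o} {e} {s} {k} {x} {z} w =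
        cast (copyWith-exec (λ _ → bit w) rStates rR refl refl
               (subst (_≤ N) (sym (length-map _ states)) states≤))
             (cong (λ r → st f v g h b c p q r o e s k x z) (map-const w states))

      fill-abilities : ∀ {d f v g h c p q r o e s k x z} w → Exec N (fill {d} w rAbilities rB)
        (st f v g h [] c p q r o e s k x z)
        (st f v g h (bits (λ _ → w) abilities) c p q r o e s k x z)
      fill-abilities {f = f} {v} {g} {h} {c} {p} {q} {r} {o} {e} {s} {k} {x} {z} w =
        cast (copyWith-exec (λ _ → bit w) rAbilities rB refl refl
               (subst (_≤ N) (sym (length-map _ abilities)) abilities≤))
             (cong (λ b → st f v g h b c p q r o e s k x z) (map-const w abilities))

      truth : (Fin ∣W∣ → Bool) → List (Token n) → List (Token n)
      truth π v = bits π states ++ comma ∷ v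

      take-truth : ∀ {d} j {σ} π {v} {_ : rV ≠ j} {_ : j ≠ zero} → get rV σ ≡ truth π v →
        get zero σ ≡ [] → get j σ ≡ [] →
        Exec N (takeUntil {d} comma? rV j) σ (set rV v (set j (bits π states) σ))
      take-truth j π {_} {a} {b} e t≡ j≡ = takeUntil-exec comma? rV j {_} {_} {b} {a}
        (all-map _ (λ _ → refl) states) refl e t≡ j≡ (bits≤ π states states≤)

      rest-state : (f v g : List (Token n)) → Store 22
      rest-state f v g = st f v g [] [] [] [] [] [] [] [] [] [] valsL []

      necessity-exec : ∀ {d f v} unit op as π → List.length as ≤ N → Exec N (necessity {d} unit op)
        (rest-state f (truth π v) (map agent as))
        (rest-state f (truth (necessity-value unit op as π) v) [])
      necessity-exec unit op as π l =
        take-truth rP π refl refl refl ⨾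
        fill-states true ⨾
        fill-abilities unit ⨾
        gather-exec op (λ _ → unit) as l ⨾
        restrict-exec (gathered op (λ _ → unit) as) π (λ _ → true) ⨾
        clear-exec rP _ (bits≤ π states states≤) ⨾
        store-exec rR rV refl (bits≤ (necessity-value unit op as π) states states≤)

      everyone-exec : ∀ {d f v g x z} as π ρ → List.length as ≤ N → Exec N (everyone {d})
        (st f v g (map agent as) [] [] (bits π states) [] (bits ρ states) [] [] [] [] x z)
        (st f v g [] [] [] (bits π states) [] (bits (everyone-value as π ρ) states) [] [] [] [] x z)
      everyone-exec {d} {f} {v} {g} {x} {z} as π ρ l =
        loop (λ as ρ → st f v g (map agent as) [] [] (bits π states) []
                          (bits ρ states) [] [] [] [] x z)
          (λ ρ a s → necessary (λ y → false ∨ capb a y) π s (ρ s) states)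
          (λ a as ρ → pop
            ( fill-abilities false
            ⨾ fetch-exec a
            ⨾ combine-exec _∨_ rB rC (λ _ → false) (capb a) abilities refl refl refl abilities≤
            ⨾ restrict-exec (λ y → false ∨ capb a y) π ρ))
          (λ ρ → pop skip)
          as ρ l

      round-exec : ∀ {d f v x} as π ρ → List.length as ≤ N → Exec N (round {d})
        (st f v (map agent as) [] [] [] [] [] (bits ρ states) [] [] [] [] x (bits π states))
        (st f v (map agent as) [] [] [] [] []
            (bits (round-value as π ρ) states) [] [] [] [] x (bits π states))
      round-exec as π ρ l =
        copy-exec rZ rP refl refl (bits≤ π states states≤) ⨾
        combine-exec _∧_ rP rR π ρ states refl refl refl states≤ ⨾
        fill-states true ⨾
        copy-exec rG rH refl refl (subst (_≤ N) (sym (length-map agent as)) l) ⨾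
        everyone-exec as (λ s → π s ∧ ρ s) (λ _ → true) l ⨾
        clear-exec rP _ (bits≤ (λ s → π s ∧ ρ s) states states≤)

      common-exec : ∀ {d f v} as π → List.length as ≤ N → Exec N (common {d})
        (rest-state f (truth π v) (map agent as))
        (rest-state f (truth (common-value as π) v) [])
      common-exec {d} {f} {v} as π l =
        take-truth rZ π refl refl refl ⨾
        fill-states true ⨾
        -- No list drives this loop: all its N iterations are rounds, in agreement with
        -- `common-value`.
        repeat (iterated N (λ _ → true)) ⨾
        clear-exec rZ _ (bits≤ π states states≤) ⨾
        clear-exec rG _ (subst (_≤ N) (sym (length-map agent as)) l) ⨾
        store-exec rR rV refl (bits≤ (common-value as π) states states≤)
        where
        I : (Fin ∣W∣ → Bool) → Store 22
        I ρ = st f v (map agent as) [] [] [] [] [] (bits ρ states) [] [] [] [] valsL (bits π states)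

        iterated : ∀ m ρ → Iter (Exec N (round {d})) m (I ρ) (I (rounds as π m ρ))
        iterated zero    ρ = []
        iterated (suc m) ρ = round-exec as π ρ l ∷ iterated m (round-value as π ρ)

      groupList≤ : ∀ G → List.length (groupList G) ≤ N
      groupList≤ G = ≤-trans (length-filter (Subset._∈? members G) (allFin n))
        (subst (_≤ N) (sym (length-tabulate id)) n≤)

      body : Prog 5
      body = pop rF (onJust handle)

      Steps : ℕ → Store 22 → Store 22 → Set
      Steps = Iter (Exec N body)

      _++ˢ_ : ∀ {m m′ σ σ′ σ″} → Steps m σ σ′ → Steps m′ σ′ σ″ → Steps (m + m′) σ σ″
      []       ++ˢ es′ = es′
      (e ∷ es) ++ˢ es′ = e ∷ (es ++ˢ es′)

      reading : List (Token n) → List (Token n) → Store 22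
      reading f v = rest-state f v []

      position-head : ∀ p qs → position p (p ∷ qs) ≡ 0
      position-head p qs = cong (λ b → if b then 0 else suc (position p qs)) (dec-true (p ≟ p) refl)

      position-tail : ∀ p q qs → p ≢ q → position p (q ∷ qs) ≡ suc (position p qs)
      position-tail p q qs p≢q =
        cong (λ b → if b then 0 else suc (position p qs)) (dec-false (p ≟ q) p≢q)

      -- Generalised from the atom list to its suffixes, because the tallies read so far have
      -- dropped the earlier rows of X. Membership of p guarantees that a row is left at the comma.
      atom-exec : ∀ p qs rest v → p ∈ qs → List.length (rows (λ p s → val s p) states qs []) ≤ N →
        Steps (suc (position p qs))
          (st (List.replicate (position p qs) tally ++ comma ∷ rest) v
              [] [] [] [] [] [] [] [] [] [] [] (rows (λ p s → val s p) states qs []) [])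
          (reading rest (truth (λ s → val s p) v))
      atom-exec p (q ∷ qs) rest v p∈ l with p ≟ q
      ... | yes refl rewrite position-head p qs = pop
            ( takeUntil-exec comma? rX rP (all-map _ (λ _ → refl) states) refl refl refl refl
                (bits≤ (λ s → val s p) states states≤)
            ⨾ store-exec rP rV refl (bits≤ (λ s → val s p) states states≤)
            ⨾ clear-exec rX _ (length-++≤ʳ (bits (λ s → val s p) states) l)
            ⨾ copy-exec rVals rX refl refl vals≤ ) ∷ []
      ... | no p≢q rewrite position-tail p q qs p≢q with p∈
      ...   | here p≡q   = contradiction p≡q p≢q
      ...   | there p∈qs = pop
            ( takeUntil-exec comma? rX rP (all-map _ (λ _ → refl) states) refl refl refl refl
                (bits≤ (λ s → val s q) states states≤)
            ⨾ clear-exec rP _ (bits≤ (λ s → val s q) states states≤) ) ∷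
            atom-exec p qs rest v p∈qs (length-++≤ʳ (bits (λ s → val s q) states) l)

      modal-exec : ∀ {d} l G π rest v → Exec N {5 + d} (handle (modal l))
        (reading (agents G ++ rest) (truth π v))
        (reading rest (truth (modal-value l (groupList G) π) v))
      modal-exec {d} l G π rest v =
        castˡ (cong (λ f → reading f (truth π v)) (++-assoc (map agent as) (comma ∷ []) rest))
              (by l)
        where
        as = groupList G

        readGroup : ∀ {d} → Exec N (takeUntil {d} comma? rF rG)
          (reading (map agent as ++ comma ∷ rest) (truth π v))
          (rest-state rest (truth π v) (map agent as))
        readGroup = takeUntil-exec comma? rF rG (all-map agent (λ _ → refl) as) refl refl refl refl
          (subst (_≤ N) (sym (length-map agent as)) (groupList≤ G))

        by : ∀ l → Exec N {5 + d} (handle (modal l))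
          (reading (map agent as ++ comma ∷ rest) (truth π v))
          (reading rest (truth (modal-value l as π) v))
        by C = readGroup ⨾ common-exec as π (groupList≤ G)
        by D = readGroup ⨾ necessity-exec false _∨_ as π (groupList≤ G)
        by M = readGroup ⨾ necessity-exec true _∧_ as π (groupList≤ G)

      -- The stack discipline of postfix notation: what lies below, v, is arbitrary. The number of
      -- iterations is only bounded, since `know` and the modalities read their arguments within
      -- their own iteration.
      Evaluates : ∀ {X} → Formula n X → Set
      Evaluates φ = ∀ rest v → ∃[ m ] m ≤ List.length (encodeFormula ps φ) ×
        Steps m (reading (encodeFormula ps φ ++ rest) v) (reading rest (truth (eval φ) v))

      -- Isolates the final operator x of a postfix formula; xs are the arguments that its handler
      -- reads from F by itself.
      evaluates-snoc : ∀ {X} (φ : Formula n X) → Evaluates φ → ∀ x xs rest v v′ →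
        Exec N (handle x) (reading (xs ++ rest) (truth (eval φ) v)) (reading rest v′) →
        ∃[ m ] m ≤ List.length (encodeFormula ps φ ++ x ∷ xs) ×
          Steps m (reading ((encodeFormula ps φ ++ x ∷ xs) ++ rest) v) (reading rest v′)
      evaluates-snoc φ ev x xs rest v v′ e =
        let m , m≤ , es = ev (x ∷ xs ++ rest) v
        in m + 1 ,
           ≤-trans (+-mono-≤ m≤ (s≤s z≤n)) (≤-reflexive (sym (length-++ (encodeFormula ps φ)))) ,
           subst (λ f → Steps (m + 1) (reading f v) (reading rest v′))
             (sym (++-assoc (encodeFormula ps φ) (x ∷ xs) rest)) (es ++ˢ (pop e ∷ []))

      formula-exec : ∀ {X} (φ : Formula n X) → All (_∈ ps) (occurrences φ) → Evaluates φ
      formula-exec (atom p) (p∈ ∷ []) rest v =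
        suc (position p ps) ,
        ≤-reflexive (sym (trans (length-++ (List.replicate (position p ps) tally))
          (trans (+-comm _ 1) (cong suc (length-replicate (position p ps)))))) ,
        subst (λ f → Steps _ (reading f v) (reading rest (truth (λ s → val s p) v)))
          (sym (++-assoc (List.replicate (position p ps) tally) (comma ∷ []) rest))
          (atom-exec p ps rest v p∈ vals≤)
      formula-exec (neg φ) all rest v =
        evaluates-snoc φ (formula-exec φ all) not [] rest v _
          ( take-truth rP (eval φ) refl refl refl
          ⨾ fill-states false
          ⨾ combine-exec implies rP rR (eval φ) (λ _ → false) states refl refl refl states≤
          ⨾ store-exec rP rV refl (bits≤ (eval (neg φ)) states states≤))
      formula-exec (φ ⇒ ψ) all rest v =
        let all₁ , all₂ = All.++⁻ (occurrences φ) all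
            m₁ , m₁≤ , es₁ = formula-exec φ all₁ ((encodeFormula ps ψ ++ imp ∷ []) ++ rest) v
            m₂ , m₂≤ , es₂ = evaluates-snoc ψ (formula-exec ψ all₂) imp [] rest (truth (eval φ) v) _
              -- The consequent was evaluated last, so its vector is on top.
              ( take-truth rR (eval ψ) refl refl refl
              ⨾ take-truth rP (eval φ) refl refl refl
              ⨾ combine-exec implies rP rR (eval φ) (eval ψ) states refl refl refl states≤
              ⨾ store-exec rP rV refl (bits≤ (eval (φ ⇒ ψ)) states states≤))
        in m₁ + m₂ ,
           ≤-trans (+-mono-≤ m₁≤ m₂≤) (≤-reflexive (sym (length-++ (encodeFormula ps φ)))) ,
           subst (λ f → Steps (m₁ + m₂) (reading f v) (reading rest (truth (eval (φ ⇒ ψ)) v)))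
             (sym (++-assoc (encodeFormula ps φ) _ rest)) (es₁ ++ˢ es₂)
      formula-exec (K a φ) all rest v =
        evaluates-snoc φ (formula-exec φ all) know (agent a ∷ []) rest v _
          (pop push ⨾ necessity-exec false _∨_ (a ∷ []) (eval φ) (≤-trans (1≤ a) n≤))
        where
        1≤ : ∀ {n} → Fin n → 1 ≤ n
        1≤ zero    = s≤s z≤n
        1≤ (suc _) = s≤s z≤n
      formula-exec (box l _ G φ) all rest v =
        evaluates-snoc φ (formula-exec φ all) (modal l) (agents G) rest v _
          (modal-exec l G (eval φ) rest v)

      no-end-rows : ∀ {Y Z : Set} (f : Y → Z → Bool) zs ys rest → All (λ x → end? x ≡ false) rest →
                    All (λ x → end? x ≡ false) (rows f zs ys rest)
      no-end-rows f zs []       rest all = all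
      no-end-rows f zs (y ∷ ys) rest all =
        All.++⁺ (all-map _ (λ _ → refl) zs) (refl ∷ no-end-rows f zs ys rest all)

      no-end-edges : ∀ ss → All (λ x → end? x ≡ false) (edgeRows ss)
      no-end-edges []       = []
      no-end-edges (s ∷ ss) = no-end-rows (edgeb s) abilities states (edgeRows ss) (no-end-edges ss)

      module _ (no-comma-chosen : All (λ x → comma? x ≡ false) chosen)
               (chosen≤ : List.length chosen ≤ N) where

        parse-exec : ∀ {d} rest → List.length (word rest) ≤ N →
          Exec N (parse {d}) (set 0F (reverse (word rest)) (empty 22)) (reading rest [])
        parse-exec {d} rest l =
          cast (move-exec 0F rF (reverse-length≤ {xs = word rest} l))
            (cong (λ f → set rF f (empty 22)) (reverse-involutive (word rest))) ⨾
          takeUntil-exec comma? rF rStates (all-map _ (λ _ → refl) states) refl refl refl refl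
            (subst (_≤ N) (sym (length-map _ states)) states≤) ⨾
          takeUntil-exec comma? rF rAbilities (all-map _ (λ _ → refl) abilities) refl refl refl refl
            (subst (_≤ N) (sym (length-map _ abilities)) abilities≤) ⨾
          takeUntil-exec end? rF rCaps (no-end-rows capb abilities (allFin n) [] [])
            refl refl refl refl caps≤ ⨾
          takeUntil-exec end? rF rEdges (no-end-edges states) refl refl refl refl edges≤ ⨾
          takeUntil-exec end? rF rVals (no-end-rows (λ p s → val s p) states ps [] [])
            refl refl refl refl vals≤ ⨾
          takeUntil-exec comma? rF rState no-comma-chosen refl refl refl refl chosen≤ ⨾
          copy-exec rVals rX refl refl vals≤

        idles : ∀ m v → Steps m (reading [] v) (reading [] v)
        idles zero    v = []
        idles (suc m) v = pop skip ∷ idles m v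

        evaluate-exec : ∀ {X} (φ : Formula n X) → All (_∈ ps) (occurrences φ) →
          suc (List.length (encodeFormula ps φ)) ≤ N →
          Exec N evaluate (reading (encodeFormula ps φ ++ end ∷ []) [])
                          (reading [] (truth (eval φ) []))
        evaluate-exec φ all l =
          let m , m≤ , es = formula-exec φ all (end ∷ []) []
              -- Of the N iterations, m read the formula, one reads the closing `end`, and o find F
              -- empty.
              o , eq = m≤n⇒∃[o]m+o≡n (≤-trans (s≤s m≤) l)
          in repeat (subst (λ j → Steps j (reading (encodeFormula ps φ ++ end ∷ []) [])
                                          (reading [] (truth (eval φ) []))) (trans (+-suc m o) eq)
               (es ++ˢ (pop skip ∷ idles o (truth (eval φ) []))))

        answer : List (Token n) → List (Token n)
        answer v = foldl (λ v _ → drop 1 v) v chosen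

        checker-exec : ∀ {X} (φ : Formula n X) → All (_∈ ps) (occurrences φ) →
          suc (List.length (encodeFormula ps φ)) ≤ N →
          List.length (word (encodeFormula ps φ ++ end ∷ [])) ≤ N →
          Exec N checker (set 0F (reverse (word (encodeFormula ps φ ++ end ∷ []))) (empty 22))
            (set rState [] (set rV (answer (truth (eval φ) [])) (reading [] [])))
        checker-exec φ all l l′ =
          parse-exec (encodeFormula ps φ ++ end ∷ []) l′ ⨾
          evaluate-exec φ all l ⨾
          loop (λ ys v → set rState ys (set rV v (reading [] []))) (λ v _ → drop 1 v)
            (λ y ys v → pop (pop skip))
            (λ v → pop skip)
            chosen (truth (eval φ) []) chosen≤

  -- The enumeration g is arbitrary so that the induction can drop its first element.
  answer-head : ∀ {Y : Set} {m} (g : Fin m → Y) (π : Y → Bool) i v →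
    List.head (foldl (λ v _ → drop 1 v) (bits π (tabulate g) ++ v)
                     (replicate {A = Token n} (toℕ i) tally)) ≡
    just (bit (π (g i)))
  answer-head g π zero    v = refl
  answer-head g π (suc i) v = answer-head (g ∘ suc) π i v

-- The length of the encoding

position≤ : ∀ p ps → position p ps ≤ List.length ps
position≤ p []       = z≤n
position≤ p (q ∷ ps) with does (p ≟ q)
... | true  = z≤n
... | false = s≤s (position≤ p ps)

occurrences≤ : ∀ {n X} (φ : Formula n X) → List.length (occurrences φ) ≤ length φ
occurrences≤ (atom p)      = ≤-refl
occurrences≤ (neg φ)       = ≤-trans (occurrences≤ φ) (m≤m+n _ _)
occurrences≤ (φ ⇒ ψ)       = ≤-trans (≤-reflexive (length-++ (occurrences φ)))
  (≤-trans (+-mono-≤ (occurrences≤ φ) (occurrences≤ ψ)) (m≤m+n _ _))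
occurrences≤ (K a φ)       = ≤-trans (occurrences≤ φ) (m≤m+n _ _)
occurrences≤ (box l _ G φ) = ≤-trans (occurrences≤ φ) (≤-trans (m≤m+n _ _) (m≤m+n _ _))

atoms≤ : ∀ {n X} (φ : Formula n X) → List.length (atoms φ) ≤ length φ
atoms≤ φ = ≤-trans (length-deduplicate _≟_ (occurrences φ)) (occurrences≤ φ)

-- Each unit of length is charged `suc (List.length ps) + n` tokens. This covers an atom, written in
-- unary; a group modality adds at most n + 2 tokens and at least two units of length.
encodeFormula≤ : ∀ {n X} ps (φ : Formula n X) →
  List.length (encodeFormula ps φ) ≤ length φ * (suc (List.length ps) + n)
encodeFormula≤ {n} ps = go
  where
  open ≤-Reasoning
  w = suc (List.length ps) + n

  snoc : ∀ {L j e l} {xs ys : List (Token n)} → List.length xs ≤ L * w → List.length ys ≡ e →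
         e ≤ j * w → L + j ≤ l → List.length (xs ++ ys) ≤ l * w
  snoc {L} {j} {e} {l} {xs} {ys} xs≤ refl e≤ L+j≤ = begin
    List.length (xs ++ ys)          ≡⟨ length-++ xs ⟩
    List.length xs + List.length ys ≤⟨ +-mono-≤ xs≤ e≤ ⟩
    L * w + j * w                   ≡⟨ *-distribʳ-+ w L j ⟨
    (L + j) * w                     ≤⟨ *-monoˡ-≤ w L+j≤ ⟩
    l * w                           ∎

  go : ∀ {X} (φ : Formula n X) → List.length (encodeFormula ps φ) ≤ length φ * w
  go (atom p) = begin
    List.length (replicate (position p ps) tally ++ comma {n} ∷ [])
      ≡⟨ length-++ (replicate (position p ps) tally) ⟩
    List.length (replicate (position p ps) (tally {n})) + 1
      ≡⟨ cong (_+ 1) (length-replicate (position p ps)) ⟩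
    position p ps + 1    ≡⟨ +-comm _ 1 ⟩
    suc (position p ps)  ≤⟨ s≤s (position≤ p ps) ⟩
    suc (List.length ps) ≤⟨ m≤m+n _ n ⟩
    w                    ≡⟨ *-identityˡ w ⟨
    1 * w                ∎
  go (neg φ) = snoc {length φ} {1} {xs = encodeFormula ps φ} (go φ) refl (s≤s z≤n) ≤-refl
  go (φ ⇒ ψ) = snoc {length φ} {length ψ + 3} {xs = encodeFormula ps φ} (go φ) refl
    (snoc {length ψ} {1} {l = length ψ + 3} {xs = encodeFormula ps ψ} (go ψ) refl (s≤s z≤n)
      (+-monoʳ-≤ (length ψ) (s≤s z≤n)))
    (≤-reflexive (sym (+-assoc (length φ) (length ψ) 3)))
  go (K a φ) = snoc {length φ} {2} {xs = encodeFormula ps φ} (go φ) refl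
    (+-mono-≤ {1} {w} (s≤s z≤n) (+-mono-≤ {1} {w} (s≤s z≤n) z≤n)) ≤-refl
  go (box l _ G φ) = snoc {length φ} {2} {xs = encodeFormula ps φ} (go φ) refl
    (begin
      suc (List.length (agents G))
        ≡⟨ cong suc (length-++ (map agent (List.filter (Subset._∈? members G) (allFin n)))) ⟩
      suc (List.length (map (agent {n}) (List.filter (Subset._∈? members G) (allFin n))) + 1)
        ≡⟨ cong (λ m → suc (m + 1))
             (length-map agent (List.filter (Subset._∈? members G) (allFin n))) ⟩
      suc (List.length (List.filter (Subset._∈? members G) (allFin n)) + 1)
        ≤⟨ s≤s (+-monoˡ-≤ 1 (length-filter (Subset._∈? members G) (allFin n))) ⟩
      suc (List.length (allFin n) + 1)
        ≡⟨ cong (λ m → suc (m + 1)) (length-tabulate {n = n} id) ⟩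
      suc (n + 1)
        ≤⟨ s≤s (+-mono-≤ (m≤n+m n (List.length ps)) (s≤s z≤n)) ⟩
      w + w
        ≡⟨ cong (w +_) (+-identityʳ w) ⟨
      2 * w ∎)
    (+-monoˡ-≤ 2 (m≤m+n (length φ) _))

replicate-tabulate : ∀ {A : Set} m (x : A) → replicate m x ≡ map (λ _ → x) (allFin m)
replicate-tabulate m x = trans (go m) (sym (map-tabulate {n = m} id (λ _ → x)))
  where
  go : ∀ m → replicate m x ≡ tabulate {n = m} (λ _ → x)
  go zero    = refl
  go (suc m) = cong (x ∷_) (go m)

-- The encoding as the word that is parsed, and the final bound

module _ (n : ℕ) {X : Pred Letter 0ℓ} {𝓒 : Pred (FiniteModel n) 0ℓ} where

  open Checker n
  open Operations n 21 using (bits)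
  open Stacks (Token n) 22 using (Store; Exec; get; set; empty)

  row-bits : ∀ {m} (v : Vec.Vec Bool m) → row v ≡ bits (Vec.lookup v) (allFin m) ++ comma ∷ []
  row-bits v = cong (_++ comma ∷ []) (trans (go v) (sym (map-tabulate id (bit ∘ Vec.lookup v))))
    where
    go : ∀ {m} (v : Vec.Vec Bool m) → map (bit {n}) (Vec.toList v) ≡ tabulate (bit ∘ Vec.lookup v)
    go Vec.[]       = refl
    go (b Vec.∷ v) = cong (bit b ∷_) (go v)

  rows-concatMap : ∀ {Y Z : Set} (f : Y → Z → Bool) zs (g : Y → List (Token n)) →
    (∀ y → g y ≡ bits (f y) zs ++ comma ∷ []) →
    ∀ ys rest → concatMap g ys ++ rest ≡ rows f zs ys rest
  rows-concatMap f zs g g≡ []       rest = refl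
  rows-concatMap f zs g g≡ (y ∷ ys) rest = begin
    (g y ++ concatMap g ys) ++ rest
      ≡⟨ ++-assoc (g y) _ rest ⟩
    g y ++ concatMap g ys ++ rest
      ≡⟨ cong₂ _++_ (g≡ y) (rows-concatMap f zs g g≡ ys rest) ⟩
    (bits (f y) zs ++ comma ∷ []) ++ rows f zs ys rest
      ≡⟨ ++-assoc (bits (f y) zs) _ _ ⟩
    bits (f y) zs ++ comma ∷ rows f zs ys rest ∎
    where open ≡-Reasoning

  length-rows : ∀ {Y Z : Set} (f : Y → Z → Bool) zs ys rest →
    List.length (rows f zs ys rest) ≡ List.length ys * suc (List.length zs) + List.length rest
  length-rows f zs []       rest = refl
  length-rows f zs (y ∷ ys) rest = begin
    List.length (bits (f y) zs ++ comma ∷ rows f zs ys rest)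
      ≡⟨ length-++ (bits (f y) zs) ⟩
    List.length (bits (f y) zs) + suc (List.length (rows f zs ys rest))
      ≡⟨ cong₂ (λ a b → a + suc b) (length-map _ zs) (length-rows f zs ys rest) ⟩
    List.length zs + suc (List.length ys * suc (List.length zs) + List.length rest)
      ≡⟨ +-suc (List.length zs) _ ⟩
    suc (List.length zs + (List.length ys * suc (List.length zs) + List.length rest))
      ≡⟨ cong suc (+-assoc (List.length zs) _ (List.length rest)) ⟨
    suc (List.length zs) + List.length ys * suc (List.length zs) + List.length rest ∎
    where open ≡-Reasoning

  module _ (x : MCInstance n X 𝓒) where

    open MCInstance x
    open FiniteModel model
    open DecisionProblem (ModelChecking n X 𝓒) using (encode; size)

    ps : List Atom
    ps = atoms formula

    chosen : List (Token n)
    chosen = replicate (toℕ state) tally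

    N : ℕ
    N = List.length (encode x)

    open Evaluation model N
    open Correctness model ps chosen N

    rest : List (Token n)
    rest = encodeFormula ps formula ++ end ∷ []

    edges-encoding : ∀ ss →
      concatMap (λ s → concatMap (λ t → row (edge s t)) states) ss ≡ edgeRows ss
    edges-encoding []       = refl
    edges-encoding (s ∷ ss) = trans
      (cong (concatMap (λ t → row (edge s t)) states ++_) (edges-encoding ss))
      (rows-concatMap (edgeb s) abilities _ (λ t → row-bits (edge s t)) states (edgeRows ss))

    encode≡word : encode x ≡ word rest
    encode≡word = begin
      (unary ∣W∣ ++ unary ∣A∣ ++ caps ++ end ∷ edges ++ end ∷ vals ++ end ∷ []) ++ tail
        ≡⟨ ++-assoc (unary ∣W∣) _ tail ⟩
      unary ∣W∣ ++ (unary ∣A∣ ++ caps ++ end ∷ edges ++ end ∷ vals ++ end ∷ []) ++ tail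
        ≡⟨ cong (unary ∣W∣ ++_) (++-assoc (unary ∣A∣) _ tail) ⟩
      unary ∣W∣ ++ unary ∣A∣ ++ (caps ++ end ∷ edges ++ end ∷ vals ++ end ∷ []) ++ tail
        ≡⟨ cong (λ l → unary ∣W∣ ++ unary ∣A∣ ++ l) (trans (++-assoc caps _ tail)
             (cong (λ l → caps ++ end ∷ l) (trans (++-assoc edges _ tail)
               (cong (λ l → edges ++ end ∷ l) (++-assoc vals _ tail))))) ⟩
      unary ∣W∣ ++ unary ∣A∣ ++ tables
        ≡⟨ trans (++-assoc (replicate ∣W∣ tally) _ _) (cong (λ l → replicate ∣W∣ tally ++ comma ∷ l)
             (++-assoc (replicate ∣A∣ tally) _ _)) ⟩
      replicate ∣W∣ tally ++ comma ∷ replicate ∣A∣ tally ++ comma ∷ tables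
        ≡⟨ cong₂ (λ l₁ l₂ → l₁ ++ comma ∷ l₂ ++ comma ∷ tables)
             (replicate-tabulate ∣W∣ tally) (replicate-tabulate ∣A∣ tally) ⟩
      statesL ++ comma ∷ abilitiesL ++ comma ∷ tables
        ≡⟨ cong (λ l → statesL ++ comma ∷ abilitiesL ++ comma ∷ l)
             (cong₂ (λ l₁ l₂ → l₁ ++ end ∷ l₂) caps≡ (cong₂ (λ l₁ l₂ → l₁ ++ end ∷ l₂)
               (edges-encoding states) (cong₂ (λ l₁ l₂ → l₁ ++ end ∷ l₂)
                 vals≡ (++-assoc chosen _ rest)))) ⟩
      word rest ∎
      where
      open ≡-Reasoning
      caps  = concatMap (λ a → row (cap a)) (allFin n)
      edges = concatMap (λ s → concatMap (λ t → row (edge s t)) (allFin ∣W∣)) (allFin ∣W∣)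
      vals  = concatMap (λ p → row (Vec.tabulate (λ s → val s p))) ps
      tail  = unary (toℕ state) ++ rest

      tables : List (Token n)
      tables = caps ++ end ∷ edges ++ end ∷ vals ++ end ∷ tail

      val-row : ∀ p → row (Vec.tabulate (λ s → val s p)) ≡ bits (λ s → val s p) states ++ comma ∷ []
      val-row p = trans (row-bits (Vec.tabulate (λ s → val s p)))
        (cong (_++ comma ∷ [])
          (map-cong (λ s → cong bit (Vec.lookup∘tabulate (λ s → val s p) s)) states))

      caps≡ : caps ≡ capsL
      caps≡ = trans (sym (++-identityʳ caps))
        (rows-concatMap capb abilities _ (λ a → row-bits (cap a)) (allFin n) [])

      vals≡ : vals ≡ valsL
      vals≡ = trans (sym (++-identityʳ vals))
        (rows-concatMap (λ p s → val s p) states _ val-row ps [])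

    length-edgeRows : ∀ ss →
      List.length (edgeRows ss) ≡
      List.length ss * (List.length states * suc (List.length abilities))
    length-edgeRows []       = refl
    length-edgeRows (s ∷ ss) = begin
      List.length (rows (edgeb s) abilities states (edgeRows ss))
        ≡⟨ length-rows (edgeb s) abilities states (edgeRows ss) ⟩
      List.length states * suc (List.length abilities) + List.length (edgeRows ss)
        ≡⟨ cong (List.length states * suc (List.length abilities) +_) (length-edgeRows ss) ⟩
      suc (List.length ss) * (List.length states * suc (List.length abilities)) ∎
      where open ≡-Reasoning

    W≡ : List.length states ≡ ∣W∣
    W≡ = length-tabulate {n = ∣W∣} id

    A≡ : List.length abilities ≡ ∣A∣
    A≡ = length-tabulate {n = ∣A∣} id

    length-caps : List.length capsL ≡ n * suc ∣A∣
    length-caps = trans (length-rows capb abilities (allFin n) []) (trans (+-identityʳ _)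
      (cong₂ (λ a b → a * suc b) (length-tabulate {n = n} id) A≡))

    length-edges : List.length edgesL ≡ ∣W∣ * (∣W∣ * suc ∣A∣)
    length-edges = trans (length-edgeRows states) (cong₂ (λ w a → w * (w * suc a)) W≡ A≡)

    length-vals : List.length valsL ≡ List.length ps * suc ∣W∣
    length-vals = trans (length-rows (λ p s → val s p) states ps []) (trans (+-identityʳ _)
      (cong (λ w → List.length ps * suc w) W≡))

    length-word : List.length (word rest) ≡
      ∣W∣ + suc (∣A∣ + suc (n * suc ∣A∣ + suc (∣W∣ * (∣W∣ * suc ∣A∣) +
        suc (List.length ps * suc ∣W∣ + suc (toℕ state +
          suc (List.length (encodeFormula ps formula) + 1))))))
    length-word =
      part statesL (trans (length-map _ states) W≡)
        (part abilitiesL (trans (length-map _ abilities) A≡) (part capsL length-caps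
          (part edgesL length-edges (part valsL length-vals
          (part chosen (length-replicate (toℕ state)) (length-++ (encodeFormula ps formula)))))))
      where
      part : ∀ (xs : List (Token n)) {y ys a b} → List.length xs ≡ a → List.length ys ≡ b →
             List.length (xs ++ y ∷ ys) ≡ a + suc b
      part xs refl refl = length-++ xs

    N≡ : N ≡ List.length (word rest)
    N≡ = cong List.length encode≡word

    -- A linear bound fails: every edge row ends in a comma even if there are no abilities, in which
    -- case the size has no quadratic term in the number of states; moreover atoms are written in
    -- unary. The summands of the length contribute the square of the size 15 times, and n times
    -- that square twice, for the capabilities and for the agents in the formula.
    N≤ : suc N ≤ (2 * n + 15) * size x ^ 2
    N≤ = begin
      suc N ≡⟨ cong suc (trans N≡ length-word) ⟩
      1 + (∣W∣ + (1 + (∣A∣ + (1 + (n * suc ∣A∣ + (1 + (∣W∣ * (∣W∣ * suc ∣A∣) +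
        (1 + (List.length ps * suc ∣W∣ + (1 + (toℕ state + (1 + (e + 1)))))))))))))
        ≤⟨ 1≤Z +≤ W≤Z +≤ 1≤Z +≤ A≤Z +≤ 1≤Z +≤ caps≤Z +≤ 1≤Z +≤ edges≤Z +≤ 1≤Z +≤ vals≤Z +≤ 1≤Z +≤
           ≤-trans (<⇒≤ (toℕ<n state)) W≤Z +≤ 1≤Z +≤ formula≤Z +≤ 1≤Z ⟩
      Z + (Z + (Z + (Z + (Z + (n * Z + (Z + ((Z + Z) + (Z + (Z + (Z + (Z + (Z +
        ((Z + n * Z) + Z)))))))))))))
        ≡⟨ solve 2 (λ n Z → Z :+ (Z :+ (Z :+ (Z :+ (Z :+ (n :* Z :+ (Z :+ ((Z :+ Z) :+
             (Z :+ (Z :+ (Z :+ (Z :+ (Z :+ ((Z :+ n :* Z) :+ Z))))))))))))) :=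
             (con 2 :* n :+ con 15) :* Z) refl n Z ⟩
      (2 * n + 15) * Z
        ≡⟨ cong (λ m → (2 * n + 15) * (z * m)) (*-identityʳ z) ⟨
      (2 * n + 15) * size x ^ 2 ∎
      where
      open ≤-Reasoning
      open +-*-Solver
      l = length formula
      e = List.length (encodeFormula ps formula)
      z = size x
      Z = z * z

      μ = ∣W∣ + ∣A∣ + ∣W∣ ^ 2 * ∣A∣ + l * ∣A∣ + ∣W∣ * l

      infixr 5 _+≤_
      _+≤_ : ∀ {a b c d} → a ≤ b → c ≤ d → a + c ≤ b + d
      _+≤_ = +-mono-≤

      <z : ∀ {m} → m ≤ l + μ → suc m ≤ z
      <z m≤ = ≤-trans (s≤s m≤) (≤-reflexive (+-comm 1 (l + μ)))

      z≤Z : z ≤ Z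
      z≤Z = m≤m*n z z ⦃ >-nonZero (<z z≤n) ⦄

      ≤Z : ∀ {m} → m ≤ z → m ≤ Z
      ≤Z m≤z = ≤-trans m≤z z≤Z

      W+A≤μ : ∣W∣ + ∣A∣ ≤ μ
      W+A≤μ = ≤-trans (m≤m+n _ (∣W∣ ^ 2 * ∣A∣)) (≤-trans (m≤m+n _ (l * ∣A∣)) (m≤m+n _ (∣W∣ * l)))

      l<z : suc l ≤ z
      l<z = <z (m≤m+n l μ)

      W<z : suc ∣W∣ ≤ z
      W<z = <z (≤-trans (≤-trans (m≤m+n ∣W∣ ∣A∣) W+A≤μ) (m≤n+m μ l))

      A<z : suc ∣A∣ ≤ z
      A<z = <z (≤-trans (≤-trans (m≤n+m ∣A∣ ∣W∣) W+A≤μ) (m≤n+m μ l))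

      W²A≤z : ∣W∣ ^ 2 * ∣A∣ ≤ z
      W²A≤z = <⇒≤ (<z (≤-trans (≤-trans (m≤n+m _ (∣W∣ + ∣A∣))
        (≤-trans (m≤m+n _ (l * ∣A∣)) (m≤m+n _ (∣W∣ * l)))) (m≤n+m μ l)))

      1≤Z : 1 ≤ Z
      1≤Z = ≤Z (<z z≤n)

      W≤Z : ∣W∣ ≤ Z
      W≤Z = ≤Z (<⇒≤ W<z)

      A≤Z : ∣A∣ ≤ Z
      A≤Z = ≤Z (<⇒≤ A<z)

      caps≤Z : n * suc ∣A∣ ≤ n * Z
      caps≤Z = *-monoʳ-≤ n (≤Z A<z)

      edges≤Z : ∣W∣ * (∣W∣ * suc ∣A∣) ≤ Z + Z
      edges≤Z = begin
        ∣W∣ * (∣W∣ * suc ∣A∣)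
          ≡⟨ solve 2 (λ w a → w :* (w :* (con 1 :+ a)) := w :* w :+ (w :^ 2) :* a) refl ∣W∣ ∣A∣ ⟩
        ∣W∣ * ∣W∣ + ∣W∣ ^ 2 * ∣A∣
          ≤⟨ *-mono-≤ (<⇒≤ W<z) (<⇒≤ W<z) +≤ ≤Z W²A≤z ⟩
        Z + Z ∎

      vals≤Z : List.length ps * suc ∣W∣ ≤ Z
      vals≤Z = *-mono-≤ (≤-trans (atoms≤ formula) (<⇒≤ l<z)) W<z

      formula≤Z : e ≤ Z + n * Z
      formula≤Z = begin
        e
          ≤⟨ encodeFormula≤ ps formula ⟩
        l * (suc (List.length ps) + n)
          ≡⟨ *-distribˡ-+ l _ n ⟩
        l * suc (List.length ps) + l * n
          ≡⟨ cong (l * suc (List.length ps) +_) (*-comm l n) ⟩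
        l * suc (List.length ps) + n * l
          ≤⟨ *-mono-≤ (<⇒≤ l<z) (≤-trans (s≤s (atoms≤ formula)) l<z) +≤ *-monoʳ-≤ n (≤Z (<⇒≤ l<z)) ⟩
        Z + n * Z ∎

    word≤ : List.length (word rest) ≤ N
    word≤ = ≤-reflexive (sym N≡)

    states≤ : List.length states ≤ N
    states≤ = subst (_≤ N) (length-map _ states) (length-++≤ˡ statesL word≤)

    abilities≤ : List.length abilities ≤ N
    abilities≤ =
      subst (_≤ N) (length-map _ abilities) (length-++≤ˡ abilitiesL (length-++≤ʳ statesL word≤))

    caps≤′ : List.length (capsL ++ end ∷ edgesL ++ end ∷ valsL ++ end ∷ chosen ++ comma ∷ rest) ≤ N
    caps≤′ = length-++≤ʳ abilitiesL (length-++≤ʳ statesL word≤)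

    edges≤′ : List.length (edgesL ++ end ∷ valsL ++ end ∷ chosen ++ comma ∷ rest) ≤ N
    edges≤′ = length-++≤ʳ capsL caps≤′

    vals≤′ : List.length (valsL ++ end ∷ chosen ++ comma ∷ rest) ≤ N
    vals≤′ = length-++≤ʳ edgesL edges≤′

    chosen≤′ : List.length (chosen ++ comma ∷ rest) ≤ N
    chosen≤′ = length-++≤ʳ valsL vals≤′

    caps≤ : List.length capsL ≤ N
    caps≤ = length-++≤ˡ capsL caps≤′

    edges≤ : List.length edgesL ≤ N
    edges≤ = length-++≤ˡ edgesL edges≤′

    vals≤ : List.length valsL ≤ N
    vals≤ = length-++≤ˡ valsL vals≤′

    chosen≤ : List.length chosen ≤ N
    chosen≤ = length-++≤ˡ chosen chosen≤′

    -- Every agent contributes a row to the capability table, which has a comma even if it has no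
    -- bits.
    n≤ : n ≤ N
    n≤ = ≤-trans (≤-trans (m≤m*n n (suc ∣A∣)) (≤-reflexive (sym length-caps))) caps≤

    formula≤ : suc (List.length (encodeFormula ps formula)) ≤ N
    formula≤ = ≤-trans
      (≤-reflexive (trans (+-comm 1 _) (sym (length-++ (encodeFormula ps formula)))))
      (length-++≤ʳ chosen chosen≤′)

    W≤N : ∣W∣ ≤ N
    W≤N = subst (_≤ N) W≡ states≤

    all-atoms : All (_∈ ps) (occurrences formula)
    all-atoms = All.tabulate (∈-deduplicate⁺ _≟_)

    started-with : List (Token n) → Store 22
    started-with w = set zero (List.reverse w) (empty 22)

    -- With the words as variables, the equation can be matched without rewriting N, which is itself
    -- defined from the encoding.
    restart : ∀ {w w′ σ} → w ≡ w′ →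
              Exec N checker (started-with w′) σ → Exec N checker (started-with w) σ
    restart refl e = e

    execution : ∃[ σ ] Exec N checker (started-with (encode x)) σ ×
                List.head (get rV σ) ≡ just (bit (eval formula state))
    execution = _ , restart encode≡word
      (checker-exec states≤ abilities≤ caps≤ edges≤ vals≤ n≤
        (All.replicate⁺ (toℕ state) refl) chosen≤ formula all-atoms formula≤ word≤) ,
      answer-head id (eval formula) state (comma ∷ [])

  accept : Maybe (Token n) → Bool
  accept (just (bit b)) = b
  accept _              = false

  open Compiler (token-finite n) 21
  open Decider checker rV accept

  modelChecking-InP : InP (ModelChecking n X 𝓒)
  modelChecking-InP = record
    { machine  = machine
    -- The exponent in `suc N` is 7, one more than the nesting depth; `N≤` turns each of the 7
    -- factors into `(2 * n + 15) * size x ^ 2`.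
    ; coeff    = bound * (2 * n + 15) ^ 7
    ; exponent = 14
    ; decides  = λ x →
        let open MCInstance x
            open DecisionProblem (ModelChecking n X 𝓒) using (encode; size)
            σ , exec , head≡ = execution x
            m , m≤ , accepts = halts (encode x) exec
        in Evaluation.eval model (N x) formula state ,
           Evaluation.eval-reflects model (N x) (W≤N x) formula state ,
           m ,
           ≤-trans m≤ (≤-trans (*-monoʳ-≤ bound (^-monoˡ-≤ 7 (N≤ x)))
                               (≤-reflexive (arrange (size x)))) ,
           trans accepts (cong (just ∘ accept) head≡)
    }
    where
    arrange : ∀ z → bound * ((2 * n + 15) * z ^ 2) ^ 7 ≡ bound * (2 * n + 15) ^ 7 * z ^ 14
    arrange z = solve 3 (λ b a z → b :* (a :* z :^ 2) :^ 7 := b :* a :^ 7 :* z :^ 14)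
      refl bound (2 * n + 15) z
      where open +-*-Solver

theorem53 : (n : ℕ) → .⦃ _ : NonZero n ⦄ → (X : Pred Letter 0ℓ) →
    InP (MC-EL n X) × InP (MC-ELˢ n X)
theorem53 n X = modelChecking-InP n , modelChecking-InP n
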